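{- Let $A$ be a finite set of integers such that $\min(A)=a$, with $3\leq a\leq 5$. Then there exist infinitely many pairwise non-isomorphic polyhedra $G$ satisfying $A_1(G)=A$.
   Context: All graphs are simple and finite. A polyhedron is a planar, $3$-connected graph. $A_1(G)$ is the set of distinct vertex degrees of $G$, i.e. $A_1(G)=\{\deg_G(u) : u\in V(G)\}$. -}

module Defs where

open import Data.Fin.Base using (Fin; _<_)
open import Data.Fin.Subset using (Subset; ∣_∣; _∉_)
open import Data.Integer.Base as ℤ using (ℤ; +_)
open import Data.List.Base using (List; []; _∷_; _++_; length; filter; allFin)
open import Data.List.Membership.Propositional using (_∈_)
open import Data.Nat.Base as ℕ using (ℕ)
open import Data.Product.Base using (∃; _×_; _,_)
open import Data.Rational.Base as ℚ using (ℚ; 0ℚ; 1ℚ)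
open import Data.Sum.Base using (_⊎_)
open import Function.Bundles using (_↔_; _⇔_; Inverse)
open import Level using (0ℓ)
open import Relation.Binary.Construct.Closure.ReflexiveTransitive using (Star)
open import Relation.Binary.Core using (Rel)
open import Relation.Binary.Definitions using (Decidable; Symmetric)
open import Relation.Binary.PropositionalEquality using (_≡_; _≢_)
open import Relation.Nullary.Negation using (¬_)
open import Relation.Unary using (Pred)

record Graph : Set₁ where
  infix 4 _∼_ _∼?_
  field
    order     : ℕ
    _∼_       : Rel (Fin order) 0ℓ
    _∼?_      : Decidable _∼_
    symmetric : Symmetric _∼_
    loopless  : ∀ {u} → ¬ (u ∼ u)

  Vertex : Set
  Vertex = Fin order

  degree : Vertex → ℕ
  degree u = length (filter (u ∼?_) (allFin order))

open Graph using (order; Vertex; degree)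

A₁ : Graph → Pred ℤ 0ℓ
A₁ G z = ∃ λ (u : Vertex G) → z ≡ + degree G u

record _≅_ (G H : Graph) : Set where
  private
    module G = Graph G
    module H = Graph H
  field
    bijection : G.Vertex ↔ H.Vertex
    adjacency : ∀ u v → (u G.∼ v) ⇔ (Inverse.to bijection u H.∼ Inverse.to bijection v)

module _ (G : Graph) where
  open Graph G using (_∼_)

  -- u and v are joined by an edge of G − X.
  StepAvoiding : Subset (order G) → Rel (Vertex G) 0ℓ
  StepAvoiding X u v = u ∼ v × u ∉ X × v ∉ X

  ConnectedWithout : Subset (order G) → Set
  ConnectedWithout X = ∀ {u v} → u ∉ X → v ∉ X → Star (StepAvoiding X) u v

  -- More than k vertices, and no fewer than k vertices disconnect the graph.
  Connected[_] : ℕ → Set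
  Connected[ k ] = k ℕ.< order G × (∀ X → ∣ X ∣ ℕ.< k → ConnectedWithout X)

-- Planarity is the existence of a drawing in the plane whose edges are
-- polygonal arcs.  The arcs have rational breakpoints, and disjointness is
-- tested on rational points.  This agrees with drawings in ℝ²: two segments
-- with rational endpoints that meet in ℝ² meet in a rational point (and in ℝ²
-- share only a rational point p if p is their only common rational point), and
-- a polygonal drawing in ℝ² can be perturbed to have rational breakpoints.

Point : Set
Point = ℚ × ℚ

-- The closed segment from p to q.
data OnSegment : Point → Point → Point → Set where
  at : ∀ {x₀ y₀ x₁ y₁} t → 0ℚ ℚ.≤ t → t ℚ.≤ 1ℚ →
       OnSegment (x₀ , y₀) (x₁ , y₁)
                 (x₀ ℚ.+ t ℚ.* (x₁ ℚ.- x₀) , y₀ ℚ.+ t ℚ.* (y₁ ℚ.- y₀))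

-- A list p₀ , p₁ , … , pₖ stands for the polygonal path with segments
-- p₀p₁ , p₁p₂ , … , pₖ₋₁pₖ.
data _OnPath_ (r : Point) : List Point → Set where
  here  : ∀ {p q ps} → OnSegment p q r → r OnPath (p ∷ q ∷ ps)
  there : ∀ {p ps} → r OnPath ps → r OnPath (p ∷ ps)

-- The path does not meet itself, so that it is an arc.
data Simple : List Point → Set where
  end  : ∀ {p} → Simple (p ∷ [])
  step : ∀ {p q ps} → p ≢ q →
         (∀ {r} → OnSegment p q r → r OnPath (q ∷ ps) → r ≡ q) →
         Simple (q ∷ ps) → Simple (p ∷ q ∷ ps)

-- Each edge {u , v} is listed once, with u < v.  The values of bends at other
-- pairs play no role.
record PlaneDrawing (G : Graph) : Set where
  open Graph G using (_∼_)

  Edge : Rel (Vertex G) 0ℓ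
  Edge u v = u < v × u ∼ v

  field
    position : Vertex G → Point
    bends    : Vertex G → Vertex G → List Point

  arc : Vertex G → Vertex G → List Point
  arc u v = position u ∷ bends u v ++ position v ∷ []

  field
    position-injective : ∀ {u v} → position u ≡ position v → u ≡ v
    arc-simple         : ∀ {u v} → Edge u v → Simple (arc u v)
    vertex-on-arc      : ∀ {u v w} → Edge u v → position w OnPath arc u v →
                         w ≡ u ⊎ w ≡ v
    arcs-meet          : ∀ {u v u′ v′ r} → Edge u v → Edge u′ v′ →
                         r OnPath arc u v → r OnPath arc u′ v′ →
                         (u ≡ u′ × v ≡ v′) ⊎ (∃ λ w → r ≡ position w)

Planar : Graph → Set
Planar = PlaneDrawing

Polyhedron : Graph → Set
Polyhedron G = Planar G × Connected[_] G 3

-- A list stands for the finite set of its members.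
IsMinimum : ℤ → List ℤ → Set
IsMinimum a A = a ∈ A × (∀ {b} → b ∈ A → a ℤ.≤ b)

{-# OPTIONS --safe #-}
module Submission where

-- All the graphs are assembled from caps.  A cap has a rim, which is a cycle of
-- length at least 3, and a second cycle of length at least 3, whose vertices are
-- called hubs.  Each rim vertex is joined to one hub, its owner, and the owners
-- advance monotonically along the rim, so that the leaves of a hub are
-- consecutive.  A rim vertex of a cap has degree 3, and a hub with l leaves has
-- degree 2 + l.  Every l ≥ 1 is possible, hence the hubs can be given any list of
-- degrees that are at least 3.
--
-- If a = 3, the graph is one cap.  If a is 4 or 5, it consists of two copies of a
-- cap whose rims are joined by a band: by rungs if a = 4, as in a prism, and by
-- rungs and diagonals if a = 5, as in an antiprism.  The band raises the degree
-- of every rim vertex to a and does not touch the hubs.  Take 3 + i hubs of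
-- degree a followed by one hub for each member of A.  Then the degrees that occur
-- are the members of A, and the order of the graph increases with i, so that
-- different i give non-isomorphic graphs.
--
-- Connectivity.  Delete at most two vertices from a cap.  If one of its two cycles
-- is intact, it connects everything, because each vertex of the other cycle has a
-- neighbour on it.  Otherwise each cycle has lost one vertex, so that both are
-- still connected, and one of three disjoint edges between them survives
-- (cap-linked).  Two copies of a cap are held together by three disjoint rungs in
-- the same way (join).
--
-- Planarity.  The vertices are placed on a horizontal line and every edge is
-- drawn as a tent above or below the line, such that no two tents on the same
-- side interleave.  The height of a tent is quadratic in its width, hence wider
-- tents are steeper and two nested tents meet at most in a common foot.  Thus
-- every such book embedding is a plane drawing (planar).  In a cap, the rim comes
-- first in cyclic order except for its last vertex, then come the hubs in reverse
-- order, and finally the last rim vertex.  The two copies of a cap are mirror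
-- images of each other, so that the edges of the band are nested above the line,
-- except for one diagonal, which runs below it around a whole cap.

open import Defs
open import Data.Integer.Base using (ℤ; +_; _≤_)
open import Data.List.Base using (List)
open import Data.List.Membership.Propositional using (_∈_)
open import Data.Nat.Base using (ℕ)
open import Data.Product.Base using (∃; _×_)
open import Relation.Binary.PropositionalEquality using (_≢_)
open import Relation.Nullary.Negation using (¬_)
open import Relation.Unary using (_≐_)

open import Data.Bool.Base using (Bool; true; false; not)
import Data.Bool.Properties as Bool
open import Data.Empty using (⊥; ⊥-elim)
open import Data.Fin.Base as Fin using (Fin; zero; suc; fromℕ; inject₁)
import Data.Fin.Induction as Fin
open import Data.Fin.Patterns using (0F; 1F; 2F)
open import Data.Fin.Permutation using (↔⇒≡)
import Data.Fin.Properties as Fin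
open import Data.Fin.Relation.Unary.Top using (view; ‵fromℕ; ‵inject₁; view-fromℕ; view-inject₁)
open import Data.Fin.Subset using (Subset; ∣_∣) renaming (_∈_ to _∈ˢ_)
import Data.Fin.Subset.Properties as Subset
open import Data.Integer.Base as ℤ using (-[1+_]; -<+; -<-; +<+)
import Data.Integer.Properties as ℤ
open import Data.List.Base
  using ([]; _∷_; _++_; length; filter; allFin; map; lookup; replicate; tabulate)
open import Data.List.Membership.Propositional.Properties
  using (∈-allFin; ∈-filter⁺; ∈-filter⁻; ∈-map⁺; ∈-map⁻; ∈-++⁺ˡ; ∈-++⁺ʳ; ∈-++⁻; ∈-lookup)
open import Data.List.Membership.Propositional.Properties.WithK using (unique∧set⇒bag)
open import Data.List.Properties using (length-map; length-++; map-tabulate; filter-none)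
open import Data.List.Relation.Binary.BagAndSetEquality using (∼bag⇒↭)
open import Data.List.Relation.Binary.Permutation.Propositional.Properties using (↭-length)
open import Data.List.Relation.Unary.All as All using (All; []; _∷_)
import Data.List.Relation.Unary.All.Properties as All
open import Data.List.Relation.Unary.AllPairs using ([]; _∷_)
open import Data.List.Relation.Unary.Any as Any using (here; there)
import Data.List.Relation.Unary.Any.Properties as Any
open import Data.List.Relation.Unary.Unique.Propositional using (Unique)
import Data.List.Relation.Unary.Unique.Propositional.Properties as Unique
open import Data.Nat.Base as ℕ using (zero; suc; z≤n; s≤s)
import Data.Nat.Coprimality as Coprimality
open import Data.Nat.ListAction using (sum)
import Data.Nat.Properties as ℕ
import Data.Nat.Solver as ℕ-Solver
open import Data.Product.Base using (∃₂; _,_; proj₁; proj₂; map₂)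
open import Data.Product.Function.NonDependent.Propositional using (_×-↔_)
open import Data.Product.Properties using (,-injectiveʳ)
open import Data.Rational.Base as ℚ using (ℚ; mkℚ; 0ℚ; 1ℚ; -_; nonNegative; positive)
import Data.Rational.Properties as ℚ
import Data.Rational.Solver as ℚ-Solver
open import Data.Sum.Base as Sum using (_⊎_; inj₁; inj₂; [_,_]′; swap)
open import Data.Sum.Properties using (inj₁-injective; inj₂-injective)
open import Function.Base using (_∘_; id)
open import Function.Bundles using (_↔_; _⇔_; Inverse; Equivalence; mk⇔)
open import Function.Construct.Composition using (_↔-∘_)
open import Level using (0ℓ)
open import Relation.Binary.Construct.Closure.ReflexiveTransitive as Star using (Star; ε; _◅_; _◅◅_)
open import Relation.Binary.Core using (Rel)
open import Relation.Binary.Definitions using (Decidable; Symmetric; tri<; tri≈; tri>)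
open import Relation.Binary.PropositionalEquality
  using (_≡_; refl; sym; trans; cong; cong₂; subst; subst₂; module ≡-Reasoning)
open import Relation.Nullary.Decidable.Core using (Dec; yes; no; _×-dec_; _⊎-dec_; ¬?)
open import Relation.Nullary.Negation.Core using (contradiction)
open import Relation.Unary using (Pred)
import Relation.Unary as Unary

-- Tents over the rational line

module Tents where
  open import Data.Rational.Base using (_+_; _*_; _-_; _<_)
  open ℚ-Solver.+-*-Solver

  sq : ∀ {i} → Polynomial i → Polynomial i
  sq x = x :* x

  0≤* : ∀ {p q} → 0ℚ ℚ.≤ p → 0ℚ ℚ.≤ q → 0ℚ ℚ.≤ p * q
  0≤* {p} {q} 0≤p 0≤q =
    subst (ℚ._≤ p * q) (ℚ.*-zeroʳ p) (ℚ.*-monoˡ-≤-nonNeg p {{nonNegative 0≤p}} 0≤q)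

  0≤+ : ∀ {p q} → 0ℚ ℚ.≤ p → 0ℚ ℚ.≤ q → 0ℚ ℚ.≤ p + q
  0≤+ = ℚ.+-mono-≤

  ≤-by : ∀ {p q} r → q ≡ p + r → 0ℚ ℚ.≤ r → p ℚ.≤ q
  ≤-by {p} r q≡ 0≤r = subst₂ ℚ._≤_ (ℚ.+-identityʳ p) (sym q≡) (ℚ.+-monoʳ-≤ p 0≤r)

  ≤⇒0≤- : ∀ {p q} → p ℚ.≤ q → 0ℚ ℚ.≤ q - p
  ≤⇒0≤- {p} {q} p≤q = subst (ℚ._≤ q - p) (ℚ.+-inverseʳ p) (ℚ.+-monoˡ-≤ (- p) p≤q)

  <⇒0<- : ∀ {p q} → p < q → 0ℚ < q - p
  <⇒0<- {p} {q} p<q = subst (_< q - p) (ℚ.+-inverseʳ p) (ℚ.+-monoˡ-< (- p) p<q)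

  -‿zero : ∀ {p q} → p - q ≡ 0ℚ → p ≡ q
  -‿zero {p} {q} eq = begin
    p            ≡⟨ solve 2 (λ p q → p := (p :- q) :+ q) refl p q ⟩
    p - q + q    ≡⟨ cong (_+ q) eq ⟩
    0ℚ + q       ≡⟨ ℚ.+-identityˡ q ⟩
    q            ∎
    where open ≡-Reasoning

  *-zero : ∀ {p q} → 0ℚ < p → p * q ≡ 0ℚ → q ≡ 0ℚ
  *-zero {p} {q} 0<p pq≡0 = ℚ.≤-antisym
    (ℚ.*-cancelˡ-≤-pos p (ℚ.≤-reflexive (trans pq≡0 (sym (ℚ.*-zeroʳ p)))))
    (ℚ.*-cancelˡ-≤-pos p (ℚ.≤-reflexive (trans (ℚ.*-zeroʳ p) (sym pq≡0))))
    where instance _ = positive 0<p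

  0<square : ∀ {p} → 0ℚ < p → 0ℚ < p * p
  0<square {p} 0<p = subst (_< p * p) (ℚ.*-zeroʳ p) (ℚ.*-monoʳ-<-pos p {{positive 0<p}} 0<p)

  -- The graph of a tent with feet at 2p and 2q and with apex (p + q , (q - p)²),
  -- as the set of pairs (X , H).  Doubling the feet makes the coordinates of the
  -- apex polynomials in p and q.  The parameter t runs from a foot to the apex, on
  -- the leg at 2p or on the leg at 2q, so that p and q play symmetric roles.
  data Tent (p q X H : ℚ) : Set where
    on : ∀ t → 0ℚ ℚ.≤ t → t ℚ.≤ 1ℚ →
         X ≡ p + p + t * (q - p) ⊎ X ≡ q + q - t * (q - p) →
         H ≡ t * ((q - p) * (q - p)) → Tent p q X H

  tent-sym : ∀ {p q X H} → Tent p q X H → Tent q p X H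
  tent-sym {p} {q} (on t 0≤t t≤1 x h) = on t 0≤t t≤1
    (swap (Sum.map
      (λ e → trans e (solve 3 (λ p q t → p :+ p :+ t :* (q :- p) := p :+ p :- t :* (p :- q)) refl p q t))
      (λ e → trans e (solve 3 (λ p q t → q :+ q :- t :* (q :- p) := q :+ q :+ t :* (p :- q)) refl p q t))
      x))
    (trans h (solve 3 (λ p q t → t :* sq (q :- p) := t :* sq (p :- q)) refl p q t))

  module _ {p q X H : ℚ} (p<q : p < q) where
    private
      δ : ℚ
      δ = q - p

      0<δ : 0ℚ < δ
      0<δ = <⇒0<- p<q

      0≤δ : 0ℚ ℚ.≤ δ
      0≤δ = ℚ.<⇒≤ 0<δ

    tent-height : Tent p q X H → 0ℚ ℚ.≤ H
    tent-height (on t 0≤t _ _ h) = subst (0ℚ ℚ.≤_) (sym h) (0≤* 0≤t (0≤* 0≤δ 0≤δ))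

    tent-foot : Tent p q X H → H ≡ 0ℚ → X ≡ p + p ⊎ X ≡ q + q
    tent-foot (on t _ _ x h) H≡0 = Sum.map
      (λ e → trans e (trans (cong (λ t → p + p + t * δ) t≡0)
        (solve 2 (λ p q → p :+ p :+ con 0ℚ :* (q :- p) := p :+ p) refl p q)))
      (λ e → trans e (trans (cong (λ t → q + q - t * δ) t≡0)
        (solve 2 (λ p q → q :+ q :- con 0ℚ :* (q :- p) := q :+ q) refl p q)))
      x
      where
      t≡0 : t ≡ 0ℚ
      t≡0 = *-zero (0<square 0<δ) (trans (ℚ.*-comm (δ * δ) t) (trans (sym h) H≡0))

    tent-left : Tent p q X H → p + p ℚ.≤ X
    tent-left (on t 0≤t t≤1 (inj₁ refl) _) = ≤-by (t * δ) refl (0≤* 0≤t 0≤δ)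
    tent-left (on t 0≤t t≤1 (inj₂ refl) _) = ≤-by ((1ℚ - t) * δ + δ)
      (solve 3 (λ p q t →
        q :+ q :- t :* (q :- p) := p :+ p :+ ((con 1ℚ :- t) :* (q :- p) :+ (q :- p))) refl p q t)
      (0≤+ (0≤* (≤⇒0≤- t≤1) 0≤δ) 0≤δ)

    -- A tent lies below the lines that carry its two legs.
    tent-left-slope : Tent p q X H → H ℚ.≤ δ * (X - (p + p))
    tent-left-slope (on t 0≤t t≤1 (inj₁ refl) refl) = ℚ.≤-reflexive
      (solve 3 (λ p q t → t :* sq (q :- p) := (q :- p) :* (p :+ p :+ t :* (q :- p) :- (p :+ p))) refl p q t)
    tent-left-slope (on t 0≤t t≤1 (inj₂ refl) refl) = ≤-by ((1ℚ - t) * (δ * δ) + (1ℚ - t) * (δ * δ))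
      (solve 3 (λ p q t → (q :- p) :* (q :+ q :- t :* (q :- p) :- (p :+ p)) :=
        t :* sq (q :- p) :+ ((con 1ℚ :- t) :* sq (q :- p) :+ (con 1ℚ :- t) :* sq (q :- p))) refl p q t)
      (0≤+ nn nn)
      where nn = 0≤* (≤⇒0≤- t≤1) (0≤* 0≤δ 0≤δ)

    tent-right : Tent p q X H → X ℚ.≤ q + q
    tent-right (on t 0≤t t≤1 (inj₁ refl) _) = ≤-by ((1ℚ - t) * δ + δ)
      (solve 3 (λ p q t →
        q :+ q := p :+ p :+ t :* (q :- p) :+ ((con 1ℚ :- t) :* (q :- p) :+ (q :- p))) refl p q t)
      (0≤+ (0≤* (≤⇒0≤- t≤1) 0≤δ) 0≤δ)
    tent-right (on t 0≤t t≤1 (inj₂ refl) _) = ≤-by (t * δ)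
      (solve 3 (λ p q t → q :+ q := q :+ q :- t :* (q :- p) :+ t :* (q :- p)) refl p q t)
      (0≤* 0≤t 0≤δ)

    tent-right-slope : Tent p q X H → H ℚ.≤ δ * (q + q - X)
    tent-right-slope (on t 0≤t t≤1 (inj₁ refl) refl) = ≤-by ((1ℚ - t) * (δ * δ) + (1ℚ - t) * (δ * δ))
      (solve 3 (λ p q t → (q :- p) :* (q :+ q :- (p :+ p :+ t :* (q :- p))) :=
        t :* sq (q :- p) :+ ((con 1ℚ :- t) :* sq (q :- p) :+ (con 1ℚ :- t) :* sq (q :- p))) refl p q t)
      (0≤+ nn nn)
      where nn = 0≤* (≤⇒0≤- t≤1) (0≤* 0≤δ 0≤δ)
    tent-right-slope (on t 0≤t t≤1 (inj₂ refl) refl) = ℚ.≤-reflexive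
      (solve 3 (λ p q t → t :* sq (q :- p) := (q :- p) :* (q :+ q :- (q :+ q :- t :* (q :- p)))) refl p q t)

    tent-sides : Tent p q X H → H ≡ δ * (X - (p + p)) ⊎ H ≡ δ * (q + q - X)
    tent-sides (on t 0≤t t≤1 (inj₁ refl) refl) = inj₁
      (solve 3 (λ p q t → t :* sq (q :- p) := (q :- p) :* (p :+ p :+ t :* (q :- p) :- (p :+ p))) refl p q t)
    tent-sides (on t 0≤t t≤1 (inj₂ refl) refl) = inj₂
      (solve 3 (λ p q t → t :* sq (q :- p) := (q :- p) :* (q :+ q :- (q :+ q :- t :* (q :- p)))) refl p q t)

    tent-end : Tent p q X H → X ≡ p + p ⊎ X ≡ q + q → H ≡ 0ℚ
    tent-end T x = ℚ.≤-antisym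
      ([ (λ { refl → subst (H ℚ.≤_)
              (solve 2 (λ p q → (q :- p) :* (p :+ p :- (p :+ p)) := con 0ℚ) refl p q)
              (tent-left-slope T) })
       , (λ { refl → subst (H ℚ.≤_)
              (solve 2 (λ p q → (q :- p) :* (q :+ q :- (q :+ q)) := con 0ℚ) refl p q)
              (tent-right-slope T) })
       ]′ x)
      (tent-height T)

  -- Lines of different slope through a point meet only there.
  steeper : ∀ {a b z} → a < b → 0ℚ ℚ.≤ z → b * z ℚ.≤ a * z → z ≡ 0ℚ
  steeper {a} {b} {z} a<b 0≤z bz≤az = ℚ.≤-antisym
    (ℚ.*-cancelˡ-≤-pos (b - a) {{positive (<⇒0<- a<b)}}
      (≤-by (a * z - b * z)
        (solve 3 (λ a b z → (b :- a) :* con 0ℚ := (b :- a) :* z :+ (a :* z :- b :* z)) refl a b z)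
        (≤⇒0≤- bz≤az)))
    0≤z

  double-mono-≤ : ∀ {p q} → p ℚ.≤ q → p + p ℚ.≤ q + q
  double-mono-≤ p≤q = ℚ.+-mono-≤ p≤q p≤q

  -- A common point lies on a leg of the wider tent, at height slope times distance
  -- to its foot.  In the narrower tent the height is at most the smaller slope
  -- times the distance to the foot on the same side, which is not larger.  So the
  -- distance to the foot of the wider tent is 0.
  nested : ∀ {l r l′ r′ X H} → l < r → l′ < r′ → l′ ℚ.≤ l → r ℚ.≤ r′ → r - l < r′ - l′ →
           Tent l r X H → Tent l′ r′ X H → X ≡ l′ + l′ ⊎ X ≡ r′ + r′
  nested {l} {r} {l′} {r′} {X} {H} l<r l′<r′ l′≤l r≤r′ δ<δ′ T T′ = Sum.map
    (λ h → -‿zero (steeper δ<δ′ (≤⇒0≤- (tent-left l′<r′ T′))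
      (subst (ℚ._≤ δ * (X - (l′ + l′))) h
        (ℚ.≤-trans (tent-left-slope l<r T)
          (ℚ.*-monoˡ-≤-nonNeg δ (ℚ.+-monoʳ-≤ X (ℚ.neg-antimono-≤ (double-mono-≤ l′≤l))))))))
    (λ h → sym (-‿zero (steeper δ<δ′ (≤⇒0≤- (tent-right l′<r′ T′))
      (subst (ℚ._≤ δ * (r′ + r′ - X)) h
        (ℚ.≤-trans (tent-right-slope l<r T)
          (ℚ.*-monoˡ-≤-nonNeg δ (ℚ.+-monoˡ-≤ (- X) (double-mono-≤ r≤r′))))))))
    (tent-sides l′<r′ T′)
    where
    δ = r - l
    instance _ = nonNegative (ℚ.<⇒≤ (<⇒0<- l<r))

  -- Tents over intervals that do not overlap can only share a foot.
  disjoint : ∀ {l r l′ r′ X H} → l < r → l′ < r′ → r ℚ.≤ l′ →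
             Tent l r X H → Tent l′ r′ X H → X ≡ r + r
  disjoint l<r l′<r′ r≤l′ T T′ =
    ℚ.≤-antisym (tent-right l<r T) (ℚ.≤-trans (double-mono-≤ r≤l′) (tent-left l′<r′ T′))

-- Tents between integers

module Meeting where
  open Tents
  open import Data.Integer.Base using (_<_)

  -- The embedding of the integers, as fractions of denominator 1, which `mkℚ`
  -- encodes by its predecessor 0.
  ι : ℤ → ℚ
  ι z = mkℚ z 0 (Coprimality.sym (Coprimality.1-coprimeTo ℤ.∣ z ∣))

  ι-injective : ∀ {i j} → ι i ≡ ι j → i ≡ j
  ι-injective = cong ℚ.numerator

  ι-mono-< : ∀ {i j} → i < j → ι i ℚ.< ι j
  ι-mono-< {i} {j} i<j = ℚ.*<* (subst₂ _<_ (sym (ℤ.*-identityʳ i)) (sym (ℤ.*-identityʳ j)) i<j)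

  ι-mono-≤ : ∀ {i j} → i ≤ j → ι i ℚ.≤ ι j
  ι-mono-≤ {i} {j} i≤j = ℚ.*≤* (subst₂ _≤_ (sym (ℤ.*-identityʳ i)) (sym (ℤ.*-identityʳ j)) i≤j)

  double : ℤ → ℚ
  double i = ι i ℚ.+ ι i

  double-injective : ∀ {i j} → double i ≡ double j → i ≡ j
  double-injective {i} {j} eq with ℤ.<-cmp i j
  ... | tri≈ _ i≡j _ = i≡j
  ... | tri< i<j _ _ = contradiction eq (ℚ.<⇒≢ (ℚ.+-mono-< (ι-mono-< i<j) (ι-mono-< i<j)))
  ... | tri> _ _ j<i = contradiction (sym eq) (ℚ.<⇒≢ (ℚ.+-mono-< (ι-mono-< j<i) (ι-mono-< j<i)))

  -- X is the abscissa of a foot of the tent between i and j.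
  Foot : ℤ → ℤ → ℚ → Set
  Foot i j X = X ≡ double i ⊎ X ≡ double j

  -- The interval from l′ to r′ does not start inside the interval from l to r
  -- and end to the right of it.
  Uncrossed : ℤ → ℤ → ℤ → ℤ → Set
  Uncrossed l r l′ r′ = ¬ (l < l′ × l′ < r × r < r′)

  nested-foot : ∀ {l r l′ r′ X H} → l < r → l′ < r′ → l′ ≤ l → r ≤ r′ → l′ < l ⊎ r < r′ →
                Tent (ι l) (ι r) X H → Tent (ι l′) (ι r′) X H → Foot l′ r′ X
  nested-foot {l} {r} l<r l′<r′ l′≤l r≤r′ proper = nested (ι-mono-< l<r) (ι-mono-< l′<r′)
    (ι-mono-≤ l′≤l) (ι-mono-≤ r≤r′)
    ([ (λ l′<l → ℚ.+-mono-≤-< (ι-mono-≤ r≤r′) (ℚ.neg-antimono-< (ι-mono-< l′<l)))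
     , (λ r<r′ → ℚ.+-mono-<-≤ (ι-mono-< r<r′) (ℚ.neg-antimono-≤ (ι-mono-≤ l′≤l)))
     ]′ proper)

  meet-right : ∀ {l r l′ r′ X H} → l < r → l′ < r′ → Uncrossed l r l′ r′ → l < l′ →
               Tent (ι l) (ι r) X H → Tent (ι l′) (ι r′) X H → Foot l r X
  meet-right {l} {r} {l′} {r′} l<r l′<r′ uncrossed l<l′ T T′ with r′ ℤ.≤? r | r ℤ.≤? l′
  ... | yes r′≤r | _        = nested-foot l′<r′ l<r (ℤ.<⇒≤ l<l′) r′≤r (inj₁ l<l′) T′ T
  ... | no _     | yes r≤l′ = inj₂ (disjoint (ι-mono-< l<r) (ι-mono-< l′<r′) (ι-mono-≤ r≤l′) T T′)
  ... | no r′≰r  | no r≰l′  = ⊥-elim (uncrossed (l<l′ , ℤ.≰⇒> r≰l′ , ℤ.≰⇒> r′≰r))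

  meet : ∀ {l r l′ r′ X H} → l < r → l′ < r′ → Uncrossed l r l′ r′ → Uncrossed l′ r′ l r →
         Tent (ι l) (ι r) X H → Tent (ι l′) (ι r′) X H →
         (l ≡ l′ × r ≡ r′) ⊎ Foot l r X ⊎ Foot l′ r′ X
  meet {l} {r} {l′} {r′} l<r l′<r′ uncrossed uncrossed′ T T′ with ℤ.<-cmp l l′
  ... | tri< l<l′ _ _ = inj₂ (inj₁ (meet-right l<r l′<r′ uncrossed l<l′ T T′))
  ... | tri> _ _ l′<l = inj₂ (inj₂ (meet-right l′<r′ l<r uncrossed′ l′<l T′ T))
  ... | tri≈ _ refl _ with ℤ.<-cmp r r′
  ...   | tri< r<r′ _ _ = inj₂ (inj₂ (nested-foot l<r l′<r′ ℤ.≤-refl (ℤ.<⇒≤ r<r′) (inj₂ r<r′) T T′))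
  ...   | tri≈ _ refl _ = inj₁ (refl , refl)
  ...   | tri> _ _ r′<r = inj₂ (inj₁ (nested-foot l′<r′ l<r ℤ.≤-refl (ℤ.<⇒≤ r′<r) (inj₂ r′<r) T′ T))

-- Book embeddings with two pages are plane drawings

-- Vertices at integers on a line, and edges in two half-planes (pages) bounded by
-- the line.  Arc b l r says that page b may hold an edge from l to r.  Since
-- arcs run from left to right, the condition `uncrossed`, which is imposed on all
-- ordered pairs of arcs of the same page, excludes every interleaving.
record BookEmbedding (G : Graph) : Set₁ where
  open Graph G using (Vertex; _∼_)
  field
    pos           : Vertex → ℤ
    pos-injective : ∀ {u v} → pos u ≡ pos v → u ≡ v
    Arc           : Bool → ℤ → ℤ → Set
    arc-<         : ∀ {b l r} → Arc b l r → l ℤ.< r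
    uncrossed     : ∀ {b l r l′ r′} → Arc b l r → Arc b l′ r′ → Meeting.Uncrossed l r l′ r′
    edge-arc      : ∀ {u v} → u ∼ v → ∃ λ b → Arc b (pos u) (pos v) ⊎ Arc b (pos v) (pos u)

module _ {G : Graph} (E : BookEmbedding G) where
  open Graph G using (Vertex; _∼_; _∼?_; loopless)
  open BookEmbedding E
  open Tents
  open Meeting
  open ℚ-Solver.+-*-Solver
  open import Data.Rational.Base using (_+_; _*_; _-_)

  -- The page of an edge.  The choice is made from the decision of adjacency, so
  -- that it depends on u and v only and not on a proof that they are adjacent.
  page : Vertex → Vertex → Bool
  page u v with u ∼? v
  ... | yes e = proj₁ (edge-arc e)
  ... | no  _ = true

  page-arc : ∀ {u v} → u ∼ v → Arc (page u v) (pos u) (pos v) ⊎ Arc (page u v) (pos v) (pos u)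
  page-arc {u} {v} e with u ∼? v
  ... | yes e′ = proj₂ (edge-arc e′)
  ... | no ¬e  = contradiction e ¬e

  -- The page `true` is the upper half-plane.
  raise : Bool → ℚ → ℚ
  raise true  h = h
  raise false h = - h

  raise-injective : ∀ b {g h} → raise b g ≡ raise b h → g ≡ h
  raise-injective true eq = eq
  raise-injective false eq = ℚ.neg-injective eq

  raise-zero : ∀ b {h} → raise b h ≡ 0ℚ → h ≡ 0ℚ
  raise-zero true  eq = eq
  raise-zero false eq = ℚ.neg-injective eq

  raise-0 : ∀ b → raise b 0ℚ ≡ 0ℚ
  raise-0 true  = refl
  raise-0 false = refl

  place : Vertex → Point
  place v = double (pos v) , 0ℚ

  apex : Bool → ℚ → ℚ → Point
  apex b p q = p + q , raise b ((q - p) * (q - p))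

  -- The arc drawn for an edge: one bend, at the apex of the tent.
  legs : Bool → ℚ → ℚ → List Point
  legs b p q = (p + p , 0ℚ) ∷ apex b p q ∷ (q + q , 0ℚ) ∷ []

  -- A tent drawn on page b.
  data RaisedTent (b : Bool) (p q : ℚ) : Point → Set where
    raised : ∀ {x y} h → y ≡ raise b h → Tent p q x h → RaisedTent b p q (x , y)

  private
    ascent : ∀ b p q t → 0ℚ + t * (raise b ((q - p) * (q - p)) - 0ℚ) ≡ raise b (t * ((q - p) * (q - p)))
    ascent true = solve 3 (λ p q t → con 0ℚ :+ t :* (sq (q :- p) :- con 0ℚ) := t :* sq (q :- p)) refl
    ascent false = solve 3 (λ p q t → con 0ℚ :+ t :* (:- sq (q :- p) :- con 0ℚ) := :- (t :* sq (q :- p))) refl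

    descent : ∀ b p q t → raise b ((q - p) * (q - p)) + t * (0ℚ - raise b ((q - p) * (q - p))) ≡
              raise b ((1ℚ - t) * ((q - p) * (q - p)))
    descent true = solve 3
      (λ p q t → sq (q :- p) :+ t :* (con 0ℚ :- sq (q :- p)) := (con 1ℚ :- t) :* sq (q :- p)) refl
    descent false = solve 3
      (λ p q t → :- sq (q :- p) :+ t :* (con 0ℚ :- :- sq (q :- p)) := :- ((con 1ℚ :- t) :* sq (q :- p))) refl

  on-legs : ∀ b p q {r} → r OnPath legs b p q → RaisedTent b p q r
  on-legs b p q (here (at t 0≤t t≤1)) =
    raised _ (ascent b p q t) (on t 0≤t t≤1
      (inj₁ (solve 3 (λ p q t → p :+ p :+ t :* (p :+ q :- (p :+ p)) := p :+ p :+ t :* (q :- p)) refl p q t)) refl)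
  on-legs b p q (there (here (at t 0≤t t≤1))) =
    raised _ (descent b p q t) (on (1ℚ - t) (≤⇒0≤- t≤1)
      (≤-by t (solve 1 (λ t → con 1ℚ := con 1ℚ :- t :+ t) refl t) 0≤t)
      (inj₂ (solve 3
        (λ p q t → p :+ q :+ t :* (q :+ q :- (p :+ q)) := q :+ q :- (con 1ℚ :- t) :* (q :- p)) refl p q t))
      refl)
  on-legs b p q (there (there (there ())))

  legs-simple : ∀ b {p q} → p ≢ q → Simple (legs b p q)
  legs-simple b {p} {q} p≢q = step (λ eq → p≢q (first (cong proj₁ eq))) corner
    (step (λ eq → p≢q (second (cong proj₁ eq))) (λ { _ (there ()) }) end)
    where
    -- q - p is not 0, whichever of p and q is larger.
    δ≢0 : ∀ {s} → s * (q - p) ≡ 0ℚ → s ≡ 0ℚ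
    δ≢0 {s} eq with ℚ.<-cmp p q
    ... | tri< p<q _ _ = *-zero (<⇒0<- p<q) (trans (ℚ.*-comm (q - p) s) eq)
    ... | tri≈ _ p≡q _ = contradiction p≡q p≢q
    ... | tri> _ _ q<p = *-zero (<⇒0<- q<p)
      (trans (solve 3 (λ p q s → (p :- q) :* s := :- (s :* (q :- p))) refl p q s) (cong -_ eq))
    first : p + p ≡ p + q → p ≡ q
    first eq = -‿zero (trans (solve 2 (λ p q → p :- q := p :+ p :- (p :+ q)) refl p q)
      (trans (cong (_- (p + q)) eq) (ℚ.+-inverseʳ (p + q))))
    second : p + q ≡ q + q → p ≡ q
    second eq = -‿zero (trans (solve 2 (λ p q → p :- q := p :+ q :- (q :+ q)) refl p q)
      (trans (cong (_- (q + q)) eq) (ℚ.+-inverseʳ (q + q))))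
    -- The first segment has abscissae between 2p and p + q, and the second one
    -- between p + q and 2q.
    meets : ∀ {t s} → 0ℚ ℚ.≤ s → t ℚ.≤ 1ℚ →
            p + p + t * (p + q - (p + p)) ≡ p + q + s * (q + q - (p + q)) → t ≡ 1ℚ
    meets {t} {s} 0≤s t≤1 eq = ℚ.≤-antisym t≤1
      (≤-by s (-‿zero (δ≢0 (begin
        (t - (1ℚ + s)) * (q - p)
          ≡⟨ solve 4 (λ p q t s → (t :- (con 1ℚ :+ s)) :* (q :- p) :=
               p :+ p :+ t :* (p :+ q :- (p :+ p)) :- (p :+ q :+ s :* (q :+ q :- (p :+ q)))) refl p q t s ⟩
        p + p + t * (p + q - (p + p)) - (p + q + s * (q + q - (p + q)))
          ≡⟨ cong (_- (p + q + s * (q + q - (p + q)))) eq ⟩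
        p + q + s * (q + q - (p + q)) - (p + q + s * (q + q - (p + q)))
          ≡⟨ ℚ.+-inverseʳ (p + q + s * (q + q - (p + q))) ⟩
        0ℚ ∎))) 0≤s)
      where open ≡-Reasoning
    to-apex : ∀ {t} → t ≡ 1ℚ → ∀ h → (p + p + t * (p + q - (p + p)) , 0ℚ + t * (h - 0ℚ)) ≡ (p + q , h)
    to-apex refl h = cong₂ _,_
      (solve 2 (λ p q → p :+ p :+ con 1ℚ :* (p :+ q :- (p :+ p)) := p :+ q) refl p q)
      (solve 1 (λ h → con 0ℚ :+ con 1ℚ :* (h :- con 0ℚ) := h) refl h)
    corner : ∀ {r} → OnSegment (p + p , 0ℚ) (apex b p q) r →
             r OnPath (apex b p q ∷ (q + q , 0ℚ) ∷ []) → r ≡ apex b p q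
    corner s₁ (here s₂) = go s₁ s₂ refl
      where
      go : ∀ {r r′} → OnSegment (p + p , 0ℚ) (apex b p q) r →
           OnSegment (apex b p q) (q + q , 0ℚ) r′ → r ≡ r′ → r ≡ apex b p q
      go (at t _ t≤1) (at s 0≤s _) eq = to-apex (meets 0≤s t≤1 (cong proj₁ eq)) _
    corner s₁ (there (there ()))

  -- The arc from i to j joins u and v, in one of the two directions.
  Ends : ℤ → ℤ → Vertex → Vertex → Set
  Ends i j u v = (i ≡ pos u × j ≡ pos v) ⊎ (i ≡ pos v × j ≡ pos u)

  edge-on : ∀ {u v r} → u ∼ v → r OnPath legs (page u v) (ι (pos u)) (ι (pos v)) →
            ∃₂ λ i j → Ends i j u v × Arc (page u v) i j × RaisedTent (page u v) (ι i) (ι j) r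
  edge-on {u} {v} e r∈ with page-arc e | on-legs (page u v) (ι (pos u)) (ι (pos v)) r∈
  ... | inj₁ a | T            = _ , _ , inj₁ (refl , refl) , a , T
  ... | inj₂ a | raised h y T = _ , _ , inj₂ (refl , refl) , a , raised h y (tent-sym T)

  -- A point in both closed half-planes is on the line.
  opposite-zero : ∀ b c {g h} → b ≢ c → 0ℚ ℚ.≤ g → 0ℚ ℚ.≤ h → raise b g ≡ raise c h → h ≡ 0ℚ
  opposite-zero true  true  b≢c _ _ _ = contradiction refl b≢c
  opposite-zero false false b≢c _ _ _ = contradiction refl b≢c
  opposite-zero true  false {h = h} _ 0≤g 0≤h eq =
    ℚ.≤-antisym (subst (ℚ._≤ 0ℚ) (solve 1 (λ h → :- (:- h) := h) refl h)
      (ℚ.neg-antimono-≤ (subst (0ℚ ℚ.≤_) eq 0≤g))) 0≤h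
  opposite-zero false true  _ 0≤g 0≤h eq =
    ℚ.≤-antisym (subst (ℚ._≤ 0ℚ) eq (ℚ.neg-antimono-≤ 0≤g)) 0≤h

  foot-end : ∀ {b i j x y} → i ℤ.< j → RaisedTent b (ι i) (ι j) (x , y) → y ≡ 0ℚ → Foot i j x
  foot-end {b} i<j (raised _ y≡ T) y≡0 = tent-foot (ι-mono-< i<j) T (raise-zero b (trans (sym y≡) y≡0))

  end-foot : ∀ {b i j x y} → i ℤ.< j → RaisedTent b (ι i) (ι j) (x , y) → Foot i j x → y ≡ 0ℚ
  end-foot {b} i<j (raised _ y≡ T) f =
    trans y≡ (trans (cong (raise b) (tent-end (ι-mono-< i<j) T f)) (raise-0 b))

  opposite-pages : ∀ {b c i j i′ j′ x y} → b ≢ c → i ℤ.< j → i′ ℤ.< j′ →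
                   RaisedTent b (ι i) (ι j) (x , y) → RaisedTent c (ι i′) (ι j′) (x , y) → y ≡ 0ℚ
  opposite-pages {b} {c} b≢c i<j i′<j′ (raised _ y≡ T) (raised _ y≡′ T′) =
    trans y≡′ (trans (cong (raise c)
      (opposite-zero b c b≢c (tent-height (ι-mono-< i<j) T) (tent-height (ι-mono-< i′<j′) T′)
        (trans (sym y≡) y≡′)))
      (raise-0 c))

  foot-vertex : ∀ {b i j u v x y} → Ends i j u v → i ℤ.< j → RaisedTent b (ι i) (ι j) (x , y) →
                Foot i j x → ∃ λ w → (x , y) ≡ place w
  foot-vertex ends i<j T f with end-foot i<j T f
  foot-vertex {u = u} (inj₁ (refl , refl)) _ _ (inj₁ refl) | refl = u , refl
  foot-vertex {v = v} (inj₁ (refl , refl)) _ _ (inj₂ refl) | refl = v , refl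
  foot-vertex {v = v} (inj₂ (refl , refl)) _ _ (inj₁ refl) | refl = v , refl
  foot-vertex {u = u} (inj₂ (refl , refl)) _ _ (inj₂ refl) | refl = u , refl

  -- Edges are listed with u < v, which excludes that two edges with the same
  -- ends are listed in opposite directions.
  same-ends : ∀ {i j u v u′ v′} → Ends i j u v → Ends i j u′ v′ → u Fin.< v → u′ Fin.< v′ → u ≡ u′ × v ≡ v′
  same-ends (inj₁ (a , b)) (inj₁ (c , d)) _ _ =
    pos-injective (trans (sym a) c) , pos-injective (trans (sym b) d)
  same-ends (inj₂ (a , b)) (inj₂ (c , d)) _ _ =
    pos-injective (trans (sym b) d) , pos-injective (trans (sym a) c)
  same-ends (inj₁ (a , b)) (inj₂ (c , d)) u<v u′<v′
    with refl ← pos-injective (trans (sym a) c) | refl ← pos-injective (trans (sym b) d) =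
    contradiction u<v (Fin.<-asym u′<v′)
  same-ends (inj₂ (a , b)) (inj₁ (c , d)) u<v u′<v′
    with refl ← pos-injective (trans (sym a) c) | refl ← pos-injective (trans (sym b) d) =
    contradiction u<v (Fin.<-asym u′<v′)

  planar : Planar G
  planar = record
    { position           = place
    ; bends              = λ u v → apex (page u v) (ι (pos u)) (ι (pos v)) ∷ []
    ; position-injective = λ eq → pos-injective (double-injective (cong proj₁ eq))
    ; arc-simple         = λ { {u} {v} (_ , e) → legs-simple (page u v)
        λ eq → loopless (subst (u ∼_) (sym (pos-injective (ι-injective eq))) e) }
    ; vertex-on-arc      = λ { (_ , e) w∈ → on-edge e w∈ }
    ; arcs-meet          = arcs-meet
    }
    where
    on-edge : ∀ {u v w} → u ∼ v → place w OnPath legs (page u v) (ι (pos u)) (ι (pos v)) → w ≡ u ⊎ w ≡ v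
    on-edge e w∈ with edge-on e w∈
    ... | i , j , ends , a , T = go ends (foot-end (arc-< a) T refl)
      where
      go : ∀ {i j u v w} → Ends i j u v → Foot i j (double (pos w)) → w ≡ u ⊎ w ≡ v
      go (inj₁ (refl , refl)) (inj₁ eq) = inj₁ (pos-injective (double-injective eq))
      go (inj₁ (refl , refl)) (inj₂ eq) = inj₂ (pos-injective (double-injective eq))
      go (inj₂ (refl , refl)) (inj₁ eq) = inj₂ (pos-injective (double-injective eq))
      go (inj₂ (refl , refl)) (inj₂ eq) = inj₁ (pos-injective (double-injective eq))
    arcs-meet : ∀ {u v u′ v′ r} → u Fin.< v × u ∼ v → u′ Fin.< v′ × u′ ∼ v′ →
                r OnPath legs (page u v) (ι (pos u)) (ι (pos v)) →
                r OnPath legs (page u′ v′) (ι (pos u′)) (ι (pos v′)) →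
                (u ≡ u′ × v ≡ v′) ⊎ (∃ λ w → r ≡ place w)
    arcs-meet {u} {v} {u′} {v′} (u<v , e) (u′<v′ , e′) r∈ r∈′
      with edge-on e r∈ | edge-on e′ r∈′
    ... | i , j , ends , a , T | i′ , j′ , ends′ , a′ , T′ with page u v Bool.≟ page u′ v′
    ...   | no b≢c = inj₂ (foot-vertex ends′ (arc-< a′) T′ (foot-end (arc-< a′) T′ y≡0))
      where
      y≡0 = opposite-pages b≢c (arc-< a) (arc-< a′) T T′
    ...   | yes b≡c with page u′ v′
    ...     | b with refl ← b≡c = go T T′
      where
      go : ∀ {r} → RaisedTent b (ι i) (ι j) r → RaisedTent b (ι i′) (ι j′) r →
           (u ≡ u′ × v ≡ v′) ⊎ (∃ λ w → r ≡ place w)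
      go T@(raised _ y≡ S) T′@(raised _ y′≡ S′)
        with refl ← raise-injective b (trans (sym y≡) y′≡)
        with meet (arc-< a) (arc-< a′) (uncrossed a a′) (uncrossed a′ a) S S′
      ... | inj₁ (refl , refl) = inj₁ (same-ends ends ends′ u<v u′<v′)
      ... | inj₂ (inj₁ f)      = inj₂ (foot-vertex ends (arc-< a) T f)
      ... | inj₂ (inj₂ f)      = inj₂ (foot-vertex ends′ (arc-< a′) T′ f)

-- Cycles

open import Data.Nat.Base using (_+_; _∸_; _*_)

private variable n : ℕ

-- Predecessor and successor in the cyclic order of Fin (suc n).
prev : Fin (suc n) → Fin (suc n)
prev zero    = fromℕ _
prev (suc i) = inject₁ i

next : Fin (suc n) → Fin (suc n)
next i with view i
... | ‵fromℕ     = zero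
... | ‵inject₁ i = suc i

prev-next : (i : Fin (suc n)) → prev (next i) ≡ i
prev-next i with view i
... | ‵fromℕ     = refl
... | ‵inject₁ i = refl

next-prev : (i : Fin (suc n)) → next (prev i) ≡ i
next-prev {n} zero rewrite view-fromℕ n      = refl
next-prev (suc i)  rewrite view-inject₁ i = refl

prev≢ : (i : Fin (2 + n)) → prev i ≢ i
prev≢ zero    ()
prev≢ (suc i) eq = ℕ.1+n≢n (sym (trans (sym (Fin.toℕ-inject₁ i)) (cong Fin.toℕ eq)))

prev²≢ : (i : Fin (3 + n)) → prev (prev i) ≢ i
prev²≢ zero          ()
prev²≢ (suc zero)    ()
prev²≢ (suc (suc i)) eq = ℕ.m≢1+n+m (Fin.toℕ i) {1} (trans
  (sym (trans (Fin.toℕ-inject₁ (inject₁ i)) (Fin.toℕ-inject₁ i))) (cong Fin.toℕ eq))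

next≢ : (i : Fin (2 + n)) → next i ≢ i
next≢ i eq = prev≢ (next i) (trans (prev-next i) (sym eq))

prev≢next : (i : Fin (3 + n)) → prev i ≢ next i
prev≢next i eq = prev²≢ (next i) (trans (cong prev (prev-next i)) eq)

-- Adjacency in a cycle.
Cyclic : Rel (Fin (suc n)) 0ℓ
Cyclic i j = i ≡ prev j ⊎ j ≡ prev i

cyclic? : Decidable (Cyclic {n})
cyclic? i j = (i Fin.≟ prev j) ⊎-dec (j Fin.≟ prev i)

cyclic-irrefl : {i : Fin (2 + n)} → ¬ Cyclic i i
cyclic-irrefl {i = i} = [ prev≢ i ∘ sym , prev≢ i ∘ sym ]′

-- Deletion of at most two vertices

-- A decidable set of vertices that contains no three distinct ones.
record Deletion (V : Set) : Set₁ where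
  field
    Gone   : V → Set
    gone?  : ∀ v → Dec (Gone v)
    at-most-two : ∀ {x y z} → Gone x → Gone y → Gone z → x ≢ y → x ≢ z → y ≢ z → ⊥

module _ {V : Set} (_~_ : Rel V 0ℓ) (D : Deletion V) where
  open Deletion D
  Step : Rel V 0ℓ
  Step u v = u ~ v × ¬ Gone u × ¬ Gone v

-- The vertices e i that remain after the deletion are connected with each other
-- by paths in the remaining graph, which may leave the image of e.
Linked : {V I : Set} → Rel V 0ℓ → Deletion V → (I → V) → Set
Linked _~_ D e = ∀ i j → ¬ Gone (e i) → ¬ Gone (e j) → Star (Step _~_ D) (e i) (e j)
  where open Deletion D

-- No deletion of at most two vertices disconnects the graph.
ThreeConnected : {V : Set} → Rel V 0ℓ → Set₁
ThreeConnected _~_ = ∀ D → Linked _~_ D (λ v → v)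

module Linking {V : Set} {_~_ : Rel V 0ℓ} (~-sym : Symmetric _~_) (D : Deletion V) where
  open Deletion D

  _⇝_ : Rel V 0ℓ
  _⇝_ = Star (Step _~_ D)

  ⇝-sym : Symmetric _⇝_
  ⇝-sym = Star.reverse λ (u~v , u , v) → ~-sym u~v , v , u

  edge : ∀ {u v} → u ~ v → ¬ Gone u → ¬ Gone v → u ⇝ v
  edge u~v u v = (u~v , u , v) ◅ ε

  module _ (e : Fin (suc n) → V) (cycle : ∀ i → e (prev i) ~ e i) where

    -- Paths along the arc of the cycle that avoids the edge from the last vertex
    -- to zero.
    path-from-zero : ∀ i → (∀ j → j Fin.≤ i → ¬ Gone (e j)) → e zero ⇝ e i
    path-from-zero = Fin.<-weakInduction _ (λ _ → ε) λ i rec present →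
      rec (λ j j≤i → present j (ℕ.m≤n⇒m≤1+n (subst (Fin.toℕ j ℕ.≤_) (Fin.toℕ-inject₁ i) j≤i)))
        ◅◅ edge (cycle (suc i)) (present _ (ℕ.m≤n⇒m≤1+n (ℕ.≤-reflexive (Fin.toℕ-inject₁ i)))) (present _ ℕ.≤-refl)

    path-to-last : ∀ i → (∀ j → i Fin.≤ j → ¬ Gone (e j)) → e i ⇝ e (fromℕ n)
    path-to-last = Fin.>-weakInduction _ (λ _ → ε) λ i rec present →
      edge (cycle (suc i)) (present _ ℕ.≤-refl) (present _ (ℕ.m≤n⇒m≤1+n (ℕ.≤-reflexive (Fin.toℕ-inject₁ i))))
        ◅◅ rec (λ j i<j → present j (ℕ.≤-trans (ℕ.≤-reflexive (Fin.toℕ-inject₁ i)) (ℕ.<⇒≤ i<j)))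

    cycle-linked : (∀ i → ¬ Gone (e i)) → Linked _~_ D e
    cycle-linked present i j _ _ =
      ⇝-sym (path-from-zero i (λ j _ → present j)) ◅◅ path-from-zero j (λ j _ → present j)

    -- Every remaining vertex is connected to a fixed one: to zero if zero remains,
    -- and otherwise to the last vertex.  If x ≢ zero, the vertices after x are
    -- connected to zero through the last vertex.
    punctured-cycle-linked : ∀ x → Gone (e x) → (∀ i → i ≢ x → ¬ Gone (e i)) → Linked _~_ D e
    punctured-cycle-linked x gone present i j i∉ j∉ =
      ⇝-sym (proj₂ base i i∉) ◅◅ proj₂ base j j∉
      where
      after : ∀ i → x Fin.< i → e i ⇝ e (fromℕ n)
      after i x<i = path-to-last i λ j i≤j → present j λ { refl → ℕ.<⇒≱ x<i i≤j }
      before : ∀ i → i Fin.< x → e zero ⇝ e i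
      before i i<x = path-from-zero i λ j j≤i → present j λ { refl → ℕ.<⇒≱ i<x j≤i }
      base : ∃ λ v → ∀ i → ¬ Gone (e i) → v ⇝ e i
      base with x Fin.≟ zero
      ... | yes refl = e (fromℕ n) , λ
        { zero i∉ → contradiction gone i∉ ; (suc i) _ → ⇝-sym (after (suc i) (s≤s z≤n)) }
      ... | no x≢0 = e zero , reach
        where
        reach : ∀ i → ¬ Gone (e i) → e zero ⇝ e i
        reach i i∉ with Fin.<-cmp i x
        ... | tri< i<x _ _ = before i i<x
        ... | tri≈ _ refl _ = contradiction gone i∉
        ... | tri> _ _ x<i = edge (~-sym (cycle zero)) (present _ (x≢0 ∘ sym))
          (present _ λ { eq → ℕ.<⇒≱ x<i (subst (i Fin.≤_) eq (Fin.≤fromℕ i)) })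
          ◅◅ ⇝-sym (after i x<i)

  -- If two linked families are joined by three disjoint edges, they are linked
  -- with each other: if all three edges were cut, they would have lost three
  -- distinct vertices.
  join : {I J : Set} (e : I → V) (d : J → V) → (∀ {i j} → e i ≢ d j) →
         (p : Fin 3 → I) (q : Fin 3 → J) → (∀ t → e (p t) ~ d (q t)) →
         (∀ {s t} → e (p s) ≡ e (p t) → s ≡ t) → (∀ {s t} → d (q s) ≡ d (q t) → s ≡ t) →
         Linked _~_ D e → Linked _~_ D d →
         ∀ i j → ¬ Gone (e i) → ¬ Gone (d j) → e i ⇝ d j
  join e d e≢d p q edges p-inj q-inj e-linked d-linked i j i∉ j∉
    with Fin.any? (λ t → ¬? (gone? (e (p t))) ×-dec ¬? (gone? (d (q t))))
  ... | yes (t , p∉ , q∉) = e-linked i (p t) i∉ p∉ ◅◅ edge (edges t) p∉ q∉ ◅◅ d-linked (q t) j q∉ j∉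
  ... | no all-cut = ⊥-elim (at-most-two
      (proj₁ (proj₂ (cut 0F))) (proj₁ (proj₂ (cut 1F))) (proj₁ (proj₂ (cut 2F)))
      (apart λ ()) (apart λ ()) (apart λ ()))
    where
    -- A deleted end of the t-th edge.
    cut : ∀ t → ∃ λ v → Gone v × (v ≡ e (p t) ⊎ v ≡ d (q t))
    cut t with gone? (e (p t)) | gone? (d (q t))
    ... | yes p∈ | _      = _ , p∈ , inj₁ refl
    ... | no _   | yes q∈ = _ , q∈ , inj₂ refl
    ... | no p∉  | no q∉  = contradiction (t , p∉ , q∉) all-cut
    apart : ∀ {s t} → s ≢ t → proj₁ (cut s) ≢ proj₁ (cut t)
    apart {s} {t} s≢t eq with proj₂ (proj₂ (cut s)) | proj₂ (proj₂ (cut t))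
    ... | inj₁ a | inj₁ b = s≢t (p-inj (trans (sym a) (trans eq b)))
    ... | inj₁ a | inj₂ b = e≢d (trans (sym a) (trans eq b))
    ... | inj₂ a | inj₁ b = e≢d (trans (sym b) (trans (sym eq) a))
    ... | inj₂ a | inj₂ b = s≢t (q-inj (trans (sym a) (trans eq b)))

-- Graphs on enumerated types

-- A graph whose vertices are given as the elements of a type V with a bijection
-- to Fin n.
module Enumerated {V : Set} (iso : Fin n ↔ V) (_~_ : Rel V 0ℓ) (_~?_ : Decidable _~_)
                  (~-sym : Symmetric _~_) (~-irrefl : ∀ {v} → ¬ (v ~ v)) where
  open Inverse iso using (to; from; strictlyInverseˡ; strictlyInverseʳ)

  graph : Graph
  graph = record
    { order     = n
    ; _∼_       = λ u v → to u ~ to v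
    ; _∼?_      = λ u v → to u ~? to v
    ; symmetric = ~-sym
    ; loopless  = ~-irrefl
    }

  to-injective : ∀ {u v} → to u ≡ to v → u ≡ v
  to-injective {u} {v} eq = trans (sym (strictlyInverseʳ u)) (trans (cong from eq) (strictlyInverseʳ v))

  -- The degree is the length of any list that contains every neighbour once.
  degree-neighbours : ∀ u {xs} → Unique xs → (∀ v → to u ~ v ⇔ v ∈ xs) → Graph.degree graph u ≡ length xs
  degree-neighbours u {xs} unique members = trans (sym (length-map to ns)) (↭-length
    (∼bag⇒↭ (unique∧set⇒bag (Unique.map⁺ to-injective (Unique.filter⁺ adjacent? (Unique.allFin⁺ n))) unique
      (λ {v} → mk⇔
        (λ v∈ → let w , w∈ , v≡ = ∈-map⁻ to v∈ in
          subst (_∈ xs) (sym v≡)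
            (Equivalence.to (members _) (proj₂ (∈-filter⁻ adjacent? {xs = allFin n} w∈))))
        (λ v∈ → subst (_∈ map to ns) (strictlyInverseˡ v)
          (∈-map⁺ to (∈-filter⁺ adjacent? (∈-allFin _)
            (subst (to u ~_) (sym (strictlyInverseˡ v)) (Equivalence.from (members v) v∈)))))))))
    where
    adjacent? : ∀ v → Dec (to u ~ to v)
    adjacent? v = to u ~? to v
    ns : List (Fin n)
    ns = filter adjacent? (allFin n)

  deletion : (X : Subset n) → ∣ X ∣ ℕ.< 3 → Deletion V
  deletion X ∣X∣<3 = record
    { Gone  = λ v → from v ∈ˢ X
    ; gone? = λ v → from v Subset.∈? X
    ; at-most-two = λ x∈ y∈ z∈ x≢y x≢z y≢z → ℕ.<⇒≱ ∣X∣<3 (three x∈ y∈ z∈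
        (x≢y ∘ from-injective) (x≢z ∘ from-injective) (y≢z ∘ from-injective))
    }
    where
    from-injective : ∀ {u v} → from u ≡ from v → u ≡ v
    from-injective {u} {v} eq = trans (sym (strictlyInverseˡ u)) (trans (cong to eq) (strictlyInverseˡ v))
    three : ∀ {x y z} → x ∈ˢ X → y ∈ˢ X → z ∈ˢ X → x ≢ y → x ≢ z → y ≢ z → 3 ℕ.≤ ∣ X ∣
    three {x} {y} {z} x∈ y∈ z∈ x≢y x≢z y≢z =
      ℕ.≤-trans (s≤s (ℕ.≤-trans (s≤s (ℕ.≤-trans (s≤s z≤n)
        (Subset.x∈p⇒∣p-x∣<∣p∣ (Subset.x∈p∧x≢y⇒x∈p-y (Subset.x∈p∧x≢y⇒x∈p-y z∈ (x≢z ∘ sym)) (y≢z ∘ sym)))))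
        (Subset.x∈p⇒∣p-x∣<∣p∣ (Subset.x∈p∧x≢y⇒x∈p-y y∈ (x≢y ∘ sym)))))
        (Subset.x∈p⇒∣p-x∣<∣p∣ x∈)

  connected : 3 ℕ.< n → ThreeConnected _~_ → Connected[_] graph 3
  connected 3<n 3-connected = 3<n , λ X ∣X∣<3 {u} {v} u∉ v∉ →
    subst₂ (Star (StepAvoiding graph X)) (strictlyInverseʳ u) (strictlyInverseʳ v)
      (Star.gmap from
        (λ { (x~y , x∉ , y∉) → subst₂ _~_ (sym (strictlyInverseˡ _)) (sym (strictlyInverseˡ _)) x~y , x∉ , y∉ })
        (3-connected (deletion X ∣X∣<3) (to u) (to v)
          (u∉ ∘ subst (_∈ˢ X) (strictlyInverseʳ u)) (v∉ ∘ subst (_∈ˢ X) (strictlyInverseʳ v))))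

  degrees : (neighbours : V → List V) → (∀ v → Unique (neighbours v)) →
            (∀ v w → v ~ w ⇔ w ∈ neighbours v) →
            ∀ {z} → A₁ graph z ⇔ ∃ λ v → z ≡ ℤ.+ length (neighbours v)
  degrees neighbours unique members = mk⇔
    (λ (u , z≡) → to u , trans z≡ (cong ℤ.+_ (degree-neighbours u (unique (to u)) (members (to u)))))
    (λ (v , z≡) → from v , trans z≡ (cong ℤ.+_ (trans (cong (λ w → length (neighbours w)) (sym (strictlyInverseˡ v)))
      (sym (degree-neighbours (from v) (unique _) (members _))))))

cyclic-neighbours : ∀ {n} {i j : Fin (suc n)} → Cyclic i j → j ≡ prev i ⊎ j ≡ next i
cyclic-neighbours (inj₁ refl) = inj₂ (sym (next-prev _))
cyclic-neighbours (inj₂ refl) = inj₁ refl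

cyclic-next : ∀ {n} (i : Fin (suc n)) → Cyclic i (next i)
cyclic-next i = inj₁ (sym (prev-next i))

-- Caps

-- A cap with 3 + m rim vertices and 3 + k hubs.  The hub of the rim vertex c is
-- owner c, and leaf j witnesses that the hub j owns some rim vertex.
module Cap {m k : ℕ} (owner : Fin (3 + m) → Fin (3 + k))
           (owner-mono : ∀ {c d} → c Fin.≤ d → owner c Fin.≤ owner d)
           (leaf : Fin (3 + k) → Fin (3 + m)) (owner-leaf : ∀ j → owner (leaf j) ≡ j) where

  V : Set
  V = Fin (3 + m) ⊎ Fin (3 + k)

  pattern rim c = inj₁ c
  pattern hub j = inj₂ j

  infix 4 _~_ _~?_

  _~_ : Rel V 0ℓ
  rim c ~ rim d = Cyclic c d
  rim c ~ hub j = owner c ≡ j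
  hub j ~ rim c = owner c ≡ j
  hub i ~ hub j = Cyclic i j

  _~?_ : Decidable _~_
  rim c ~? rim d = cyclic? c d
  rim c ~? hub j = owner c Fin.≟ j
  hub j ~? rim c = owner c Fin.≟ j
  hub i ~? hub j = cyclic? i j

  ~-sym : Symmetric _~_
  ~-sym {rim _} {rim _} = swap
  ~-sym {rim _} {hub _} = id
  ~-sym {hub _} {rim _} = id
  ~-sym {hub _} {hub _} = swap

  ~-irrefl : ∀ {v} → ¬ (v ~ v)
  ~-irrefl {rim _} = cyclic-irrefl
  ~-irrefl {hub _} = cyclic-irrefl

  -- The rim vertices that belong to the hub j.
  leaves : Fin (3 + k) → List (Fin (3 + m))
  leaves j = filter (λ c → owner c Fin.≟ j) (allFin _)

  neighbours : V → List V
  neighbours (rim c) = rim (prev c) ∷ rim (next c) ∷ hub (owner c) ∷ []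
  neighbours (hub j) = hub (prev j) ∷ hub (next j) ∷ map rim (leaves j)

  neighbours-unique : ∀ v → Unique (neighbours v)
  neighbours-unique (rim c) =
    ((prev≢next c ∘ inj₁-injective) ∷ (λ ()) ∷ []) ∷ ((λ ()) ∷ []) ∷ [] ∷ []
  neighbours-unique (hub j) =
    ((prev≢next j ∘ inj₂-injective) ∷ no-rim) ∷ no-rim ∷
    Unique.map⁺ inj₁-injective (Unique.filter⁺ (λ c → owner c Fin.≟ j) (Unique.allFin⁺ _))
    where
    no-rim : ∀ {i} → All (hub i ≢_) (map rim (leaves j))
    no-rim = All.map⁺ (All.universal (λ _ ()) _)

  ∈-leaves : ∀ {c j} → owner c ≡ j → c ∈ leaves j
  ∈-leaves {c} {j} = ∈-filter⁺ (λ c → owner c Fin.≟ j) (∈-allFin c)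

  leaves-∈ : ∀ {c j} → c ∈ leaves j → owner c ≡ j
  leaves-∈ {c} {j} c∈ = proj₂ (∈-filter⁻ (λ c → owner c Fin.≟ j) {xs = allFin _} c∈)

  neighbours-complete : ∀ {v w} → v ~ w → w ∈ neighbours v
  neighbours-complete {rim c} {rim d} e =
    [ (λ eq → here (cong rim eq)) , (λ eq → there (here (cong rim eq))) ]′ (cyclic-neighbours e)
  neighbours-complete {rim c} {hub j} refl = there (there (here refl))
  neighbours-complete {hub j} {rim c} e = there (there (∈-map⁺ rim (∈-leaves e)))
  neighbours-complete {hub i} {hub j} e =
    [ (λ eq → here (cong hub eq)) , (λ eq → there (here (cong hub eq))) ]′ (cyclic-neighbours e)

  neighbours-sound : ∀ {v w} → w ∈ neighbours v → v ~ w
  neighbours-sound {rim c} (here refl)                 = inj₂ refl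
  neighbours-sound {rim c} (there (here refl))         = cyclic-next c
  neighbours-sound {rim c} (there (there (here refl))) = refl
  neighbours-sound {hub j} (here refl)                 = inj₂ refl
  neighbours-sound {hub j} (there (here refl))         = cyclic-next j
  neighbours-sound {hub j} (there (there w∈)) with c , c∈ , refl ← ∈-map⁻ rim w∈ = leaves-∈ c∈

  -- A copy of the cap inside a graph on W.
  module _ {W : Set} {_≈_ : Rel W 0ℓ} (≈-sym : Symmetric _≈_) (e : V → W)
           (e-injective : ∀ {u v} → e u ≡ e v → u ≡ v) (e-edge : ∀ {u v} → u ~ v → e u ≈ e v)
           (D : Deletion W) where
    open Deletion D
    open Linking {_~_ = _≈_} ≈-sym D

    private
      rim-cycle : ∀ i → e (rim (prev i)) ≈ e (rim i)
      rim-cycle i = e-edge (inj₁ refl)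

      hub-cycle : ∀ i → e (hub (prev i)) ≈ e (hub i)
      hub-cycle i = e-edge (inj₁ refl)

      linked-by-rows : Linked _≈_ D (e ∘ rim) → Linked _≈_ D (e ∘ hub) →
                       (∀ c j → ¬ Gone (e (rim c)) → ¬ Gone (e (hub j)) → e (rim c) ⇝ e (hub j)) →
                       Linked _≈_ D e
      linked-by-rows r h x (rim c) (rim d) c∉ d∉ = r c d c∉ d∉
      linked-by-rows r h x (rim c) (hub j) c∉ j∉ = x c j c∉ j∉
      linked-by-rows r h x (hub j) (rim c) j∉ c∉ = ⇝-sym (x c j c∉ j∉)
      linked-by-rows r h x (hub i) (hub j) i∉ j∉ = h i j i∉ j∉

    -- The copy loses no three vertices.  So if it loses a rim vertex and a hub, all
    -- other rim vertices and hubs remain, and both cycles are only punctured.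
    cap-linked : Linked _≈_ D e
    cap-linked with Fin.any? (λ c → gone? (e (rim c))) | Fin.any? (λ j → gone? (e (hub j)))
    ... | no intact | _ = λ u v u∉ v∉ →
      proj₂ (reach u u∉)
        ◅◅ cycle-linked (e ∘ rim) rim-cycle present _ _ (present _) (present _)
        ◅◅ ⇝-sym (proj₂ (reach v v∉))
      where
      present : ∀ c → ¬ Gone (e (rim c))
      present c c∈ = intact (c , c∈)
      reach : ∀ v → ¬ Gone (e v) → ∃ λ c → e v ⇝ e (rim c)
      reach (rim c) _  = c , ε
      reach (hub j) j∉ = leaf j , edge (e-edge (owner-leaf j)) j∉ (present _)
    ... | yes _ | no intact = λ u v u∉ v∉ →
      proj₂ (reach u u∉)
        ◅◅ cycle-linked (e ∘ hub) hub-cycle present _ _ (present _) (present _)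
        ◅◅ ⇝-sym (proj₂ (reach v v∉))
      where
      present : ∀ j → ¬ Gone (e (hub j))
      present j j∈ = intact (j , j∈)
      reach : ∀ v → ¬ Gone (e v) → ∃ λ j → e v ⇝ e (hub j)
      reach (rim c) c∉ = owner c , edge (e-edge refl) c∉ (present _)
      reach (hub j) _  = j , ε
    ... | yes (c , c∈) | yes (j , j∈) = linked-by-rows rims hubs
      (join (e ∘ rim) (e ∘ hub) (λ eq → rim≢hub (e-injective eq)) (leaf ∘ three) three
        (λ t → e-edge (owner-leaf (three t)))
        (λ eq → three-injective (trans (sym (owner-leaf _))
          (trans (cong owner (inj₁-injective (e-injective eq))) (owner-leaf _))))
        (λ eq → three-injective (inj₂-injective (e-injective eq)))
        rims hubs)
      where
      rim≢hub : ∀ {i j} → rim i ≢ hub j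
      rim≢hub ()
      three : Fin 3 → Fin (3 + k)
      three t = t Fin.↑ˡ k
      three-injective : ∀ {s t} → three s ≡ three t → s ≡ t
      three-injective = Fin.↑ˡ-injective k _ _
      rims : Linked _≈_ D (e ∘ rim)
      rims = punctured-cycle-linked (e ∘ rim) rim-cycle c c∈ λ i i≢c i∈ →
        at-most-two i∈ c∈ j∈ (i≢c ∘ inj₁-injective ∘ e-injective)
          (rim≢hub ∘ e-injective) (rim≢hub ∘ e-injective)
      hubs : Linked _≈_ D (e ∘ hub)
      hubs = punctured-cycle-linked (e ∘ hub) hub-cycle j j∈ λ i i≢j i∈ →
        at-most-two i∈ j∈ c∈ (i≢j ∘ inj₂-injective ∘ e-injective)
          (rim≢hub ∘ sym ∘ e-injective) (rim≢hub ∘ sym ∘ e-injective)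

  -- The layout of a cap, on the positions 0, 1, …, top: the rim vertices from 0 to
  -- 1 + m, the hubs from the last one down to 0, and at top the last rim vertex.
  -- The number last-rim is the index of the last rim vertex and also the position
  -- of the last hub.
  last-rim last-hub top : ℕ
  last-rim = 2 + m
  last-hub = 2 + k
  top = last-rim + suc last-hub

  rim-level : Fin (3 + m) → ℕ
  rim-level c with view c
  ... | ‵fromℕ     = top
  ... | ‵inject₁ c = Fin.toℕ c

  level : V → ℕ
  level (rim c) = rim-level c
  level (hub j) = last-rim + (last-hub ∸ Fin.toℕ j)

  rim-level-last : rim-level (fromℕ _) ≡ top
  rim-level-last rewrite view-fromℕ last-rim = refl

  rim-level-inject₁ : ∀ c → rim-level (inject₁ c) ≡ Fin.toℕ c
  rim-level-inject₁ c rewrite view-inject₁ c = refl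

  hub<top : ∀ j → level (hub j) ℕ.< top
  hub<top j = ℕ.+-monoʳ-< last-rim (s≤s (ℕ.m∸n≤m last-hub (Fin.toℕ j)))

  last-rim≤hub : ∀ j → last-rim ℕ.≤ level (hub j)
  last-rim≤hub j = ℕ.m≤m+n last-rim _

  rim<hub : ∀ (c : Fin last-rim) j → Fin.toℕ c ℕ.< level (hub j)
  rim<hub c j = ℕ.<-≤-trans (Fin.toℕ<n c) (last-rim≤hub j)

  rim<top : ∀ (c : Fin last-rim) → Fin.toℕ c ℕ.< top
  rim<top c = ℕ.<-≤-trans (Fin.toℕ<n c) (ℕ.m≤m+n last-rim _)

  rim-level-mono : ∀ {c d} → c Fin.≤ d → rim-level c ℕ.≤ rim-level d
  rim-level-mono {c} {d} c≤d with view c | view d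
  ... | ‵fromℕ     | ‵fromℕ     = ℕ.≤-refl
  ... | ‵fromℕ     | ‵inject₁ d = contradiction c≤d (ℕ.<⇒≱
    (ℕ.<-≤-trans (ℕ.≤-<-trans (ℕ.≤-reflexive (Fin.toℕ-inject₁ d)) (Fin.toℕ<n d))
      (ℕ.≤-reflexive (sym (Fin.toℕ-fromℕ last-rim)))))
  ... | ‵inject₁ c | ‵fromℕ     = ℕ.<⇒≤ (rim<top c)
  ... | ‵inject₁ c | ‵inject₁ d = subst₂ ℕ._≤_ (Fin.toℕ-inject₁ c) (Fin.toℕ-inject₁ d) c≤d

  level-injective : ∀ {u v} → level u ≡ level v → u ≡ v
  level-injective {rim c} {rim d} eq with view c | view d
  ... | ‵fromℕ     | ‵fromℕ     = refl
  ... | ‵fromℕ     | ‵inject₁ d = contradiction (sym eq) (ℕ.<⇒≢ (rim<top d))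
  ... | ‵inject₁ c | ‵fromℕ     = contradiction eq (ℕ.<⇒≢ (rim<top c))
  ... | ‵inject₁ c | ‵inject₁ d = cong (rim ∘ inject₁) (Fin.toℕ-injective eq)
  level-injective {rim c} {hub j} eq with view c
  ... | ‵fromℕ     = contradiction (sym eq) (ℕ.<⇒≢ (hub<top j))
  ... | ‵inject₁ c = contradiction eq (ℕ.<⇒≢ (rim<hub c j))
  level-injective {hub j} {rim c} eq with view c
  ... | ‵fromℕ     = contradiction eq (ℕ.<⇒≢ (hub<top j))
  ... | ‵inject₁ c = contradiction (sym eq) (ℕ.<⇒≢ (rim<hub c j))
  level-injective {hub i} {hub j} eq = cong hub (Fin.toℕ-injective
    (ℕ.∸-cancelˡ-≡ (ℕ.≤-pred (Fin.toℕ<n i)) (ℕ.≤-pred (Fin.toℕ<n j)) (ℕ.+-cancelˡ-≡ last-rim _ _ eq)))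

  -- The arcs of a cap.  On the lower page are the edges between consecutive
  -- positions, the edge between the two ends of the rim, which spans everything,
  -- and all spokes but one, nested because owner is monotone.  The upper page
  -- holds the edge from the rim vertex 1 + m to the last one, the edge that closes
  -- the cycle of the hubs, and the spoke from the last rim vertex to its hub, which
  -- is the last one.  These three stay to the right of the rim vertices before
  -- 1 + m.
  data Arc : Bool → ℕ → ℕ → Set where
    unit       : ∀ {l} → l ℕ.< top → Arc false l (suc l)
    outer      : Arc false 0 top
    spoke      : (c : Fin last-rim) → Arc false (Fin.toℕ c) (level (hub (owner (inject₁ c))))
    last-side  : Arc true (1 + m) top
    hub-side   : Arc true last-rim (last-rim + last-hub)
    last-spoke : Arc true last-rim top

  arc-< : ∀ {b l r} → Arc b l r → l ℕ.< r
  arc-< (unit _)   = ℕ.≤-refl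
  arc-< outer      = s≤s z≤n
  arc-< (spoke c)  = rim<hub c (owner (inject₁ c))
  arc-< last-side  = ℕ.m≤m+n last-rim _
  arc-< hub-side   = ℕ.m<m+n last-rim (s≤s z≤n)
  arc-< last-spoke = ℕ.m<m+n last-rim (s≤s z≤n)

  arc-≤top : ∀ {b l r} → Arc b l r → r ℕ.≤ top
  arc-≤top (unit l<top) = l<top
  arc-≤top outer        = ℕ.≤-refl
  arc-≤top (spoke c)    = ℕ.<⇒≤ (hub<top (owner (inject₁ c)))
  arc-≤top last-side    = ℕ.≤-refl
  arc-≤top hub-side     = ℕ.+-monoʳ-≤ last-rim (ℕ.n≤1+n _)
  arc-≤top last-spoke   = ℕ.≤-refl

  arcs-uncrossed : ∀ {b l r l′ r′} → Arc b l r → Arc b l′ r′ →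
                   l ℕ.< l′ → l′ ℕ.< r → r ℕ.< r′ → ⊥
  arcs-uncrossed (unit _)   _    l<l′ l′<r _ = ℕ.<⇒≱ l′<r l<l′
  arcs-uncrossed outer      a    _ _ r<r′    = ℕ.<⇒≱ r<r′ (arc-≤top a)
  arcs-uncrossed last-side  a    _ _ r<r′    = ℕ.<⇒≱ r<r′ (arc-≤top a)
  arcs-uncrossed last-spoke a    _ _ r<r′    = ℕ.<⇒≱ r<r′ (arc-≤top a)
  arcs-uncrossed (spoke c)  (unit _)  _ l′<r r<r′ = ℕ.<⇒≱ r<r′ l′<r
  arcs-uncrossed (spoke c)  (spoke d) c<d _ r<r′ =
    ℕ.<⇒≱ r<r′ (ℕ.+-monoʳ-≤ last-rim (ℕ.∸-monoʳ-≤ last-hub (owner-mono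
      (subst₂ ℕ._≤_ (sym (Fin.toℕ-inject₁ c)) (sym (Fin.toℕ-inject₁ d)) (ℕ.<⇒≤ c<d)))))
  arcs-uncrossed hub-side   last-side  l<l′ _ _ = ℕ.<⇒≱ l<l′ (ℕ.n≤1+n _)
  arcs-uncrossed hub-side   hub-side   l<l′ _ _ = ℕ.<-irrefl refl l<l′
  arcs-uncrossed hub-side   last-spoke l<l′ _ _ = ℕ.<-irrefl refl l<l′

  -- No upper arc passes over a rim vertex, so that all rim vertices can be reached
  -- from above.
  rim-outside : ∀ {l r} c → Arc true l r → l ℕ.< rim-level c → rim-level c ℕ.< r → ⊥
  rim-outside c a l<c c<r with view c
  ... | ‵fromℕ     = ℕ.<⇒≱ c<r (arc-≤top a)
  ... | ‵inject₁ c = ℕ.<⇒≱ (Fin.toℕ<n c) (ℕ.≤-trans (s≤s (1+m≤ a)) l<c)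
    where
    1+m≤ : ∀ {l r} → Arc true l r → 1 + m ℕ.≤ l
    1+m≤ last-side  = ℕ.≤-refl
    1+m≤ hub-side   = ℕ.n≤1+n _
    1+m≤ last-spoke = ℕ.n≤1+n _

  owner-last : owner (fromℕ _) ≡ fromℕ _
  owner-last = Fin.≤-antisym (Fin.≤fromℕ _)
    (subst (Fin._≤ owner (fromℕ _)) (owner-leaf (fromℕ _)) (owner-mono (Fin.≤fromℕ _)))

  -- There is an arc between two positions, in one of the two directions.
  Joined : ℕ → ℕ → Set
  Joined l r = ∃ λ b → Arc b l r ⊎ Arc b r l

  Joined-sym : ∀ {l r} → Joined l r → Joined r l
  Joined-sym = map₂ swap

  rim-arc : ∀ c → Joined (rim-level (prev c)) (rim-level c)
  rim-arc zero = subst (λ l → Joined l 0) (sym rim-level-last) (false , inj₂ outer)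
  rim-arc (suc c) rewrite rim-level-inject₁ c with view c
  ... | ‵fromℕ     = true , inj₁ (subst (λ l → Arc true l top) (sym (Fin.toℕ-fromℕ (1 + m))) last-side)
  ... | ‵inject₁ d = false , inj₁ (subst (λ l → Arc false l (suc (Fin.toℕ d))) (sym (Fin.toℕ-inject₁ d))
      (unit (ℕ.<⇒≤ (rim<top (suc d)))))

  hub-arc : ∀ j → Joined (level (hub (prev j))) (level (hub j))
  hub-arc zero = true , inj₁ (subst (λ l → Arc true l (last-rim + last-hub)) (sym last-hub-level) hub-side)
    where
    last-hub-level : level (hub (fromℕ last-hub)) ≡ last-rim
    last-hub-level = trans (cong (λ j → last-rim + (last-hub ∸ j)) (Fin.toℕ-fromℕ last-hub))
      (trans (cong (λ i → last-rim + i) (ℕ.n∸n≡0 last-hub)) (ℕ.+-identityʳ last-rim))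
  hub-arc (suc j) = false , inj₂ (subst (Arc false _) (sym next-level) (unit (hub<top (suc j))))
    where
    next-level : level (hub (inject₁ j)) ≡ suc (level (hub (suc j)))
    next-level = trans (cong (λ j → last-rim + (last-hub ∸ j)) (Fin.toℕ-inject₁ j))
      (trans (cong (λ i → last-rim + i) (ℕ.+-∸-assoc 1 (Fin.toℕ<n j))) (ℕ.+-suc last-rim _))

  spoke-arc : ∀ c → Joined (rim-level c) (level (hub (owner c)))
  spoke-arc c with view c
  ... | ‵fromℕ     = true , inj₂ (subst (λ l → Arc true l top) (sym level≡) last-spoke)
    where
    level≡ : level (hub (owner (fromℕ _))) ≡ last-rim
    level≡ = trans (cong (λ j → last-rim + (last-hub ∸ Fin.toℕ j)) owner-last)
      (trans (cong (λ j → last-rim + (last-hub ∸ j)) (Fin.toℕ-fromℕ last-hub))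
      (trans (cong (λ i → last-rim + i) (ℕ.n∸n≡0 last-hub)) (ℕ.+-identityʳ last-rim)))
  ... | ‵inject₁ c = false , inj₁ (spoke c)

  joined : ∀ {u v} → u ~ v → Joined (level u) (level v)
  joined {rim c} {rim d} (inj₁ refl) = rim-arc d
  joined {rim c} {rim d} (inj₂ refl) = Joined-sym (rim-arc c)
  joined {rim c} {hub j} refl        = spoke-arc c
  joined {hub j} {rim c} refl        = Joined-sym (spoke-arc c)
  joined {hub i} {hub j} (inj₁ refl) = hub-arc j
  joined {hub i} {hub j} (inj₂ refl) = Joined-sym (hub-arc i)

-- Single caps and pairs of caps

module Graphs {m k : ℕ} (owner : Fin (3 + m) → Fin (3 + k))
           (owner-mono : ∀ {c d} → c Fin.≤ d → owner c Fin.≤ owner d)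
           (leaf : Fin (3 + k) → Fin (3 + m)) (owner-leaf : ∀ j → owner (leaf j) ≡ j) where

  open Cap owner owner-mono leaf owner-leaf

  -- The arcs of two caps.  Position p of one cap is at the integer p and that of
  -- the other cap at its mirror image -1 - p.  The edges of the band nest around
  -- the middle on the upper page, except for the diagonal that closes the band.  It
  -- joins the innermost vertex of the left cap to the outermost one of the right
  -- cap and runs below the whole right cap.
  data Arc² : Bool → ℤ → ℤ → Set where
    front : ∀ {b l r} → Arc b l r → Arc² b (ℤ.+ l) (ℤ.+ r)
    back  : ∀ {b l r} → Arc b l r → Arc² b -[1+ r ] -[1+ l ]
    link  : ∀ c d → d Fin.≤ c → Fin.toℕ c ℕ.≤ suc (Fin.toℕ d) →
            Arc² true -[1+ rim-level c ] (ℤ.+ rim-level d)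
    twist : Arc² false -[1+ 0 ] (ℤ.+ top)

  arc²-< : ∀ {b l r} → Arc² b l r → l ℤ.< r
  arc²-< (front a)      = +<+ (arc-< a)
  arc²-< (back a)       = -<- (arc-< a)
  arc²-< (link _ _ _ _) = -<+
  arc²-< twist          = -<+

  rim-level-cancel-< : ∀ {c d} → rim-level c ℕ.< rim-level d → c Fin.< d
  rim-level-cancel-< c<d = ℕ.≰⇒> λ d≤c → ℕ.<⇒≱ c<d (rim-level-mono d≤c)

  arcs²-uncrossed : ∀ {b l r l′ r′} → Arc² b l r → Arc² b l′ r′ →
                    Meeting.Uncrossed l r l′ r′
  arcs²-uncrossed (front a) (front a′) (+<+ p , +<+ q , +<+ s) = arcs-uncrossed a a′ p q s
  arcs²-uncrossed (front _) (back _) (() , _)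
  arcs²-uncrossed (front _) (link _ _ _ _) (() , _)
  arcs²-uncrossed (front _) twist (() , _)
  arcs²-uncrossed (back _) (front _) (_ , () , _)
  arcs²-uncrossed (back a) (back a′) (-<- p , -<- q , -<- s) = arcs-uncrossed a′ a s q p
  arcs²-uncrossed (back a) (link c _ _ _) (-<- p , -<- q , _) = rim-outside c a q p
  arcs²-uncrossed (back _) twist (_ , -<- () , _)
  arcs²-uncrossed (link _ d _ _) (front a) (_ , +<+ p , +<+ q) = rim-outside d a p q
  arcs²-uncrossed (link _ _ _ _) (back _) (_ , _ , ())
  arcs²-uncrossed (link c d d≤c c≤1+d) (link c′ d′ d′≤c′ _) (-<- p , _ , +<+ q) =
    ℕ.<⇒≱ (rim-level-cancel-< p) (ℕ.≤-trans c≤1+d (ℕ.≤-trans (rim-level-cancel-< q) d′≤c′))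
  arcs²-uncrossed twist (front a) (_ , _ , +<+ p) = ℕ.<⇒≱ p (arc-≤top a)
  arcs²-uncrossed twist (back _) (_ , _ , ())
  arcs²-uncrossed twist twist (-<- () , _)

  3<order : 3 ℕ.< (3 + m) + (3 + k)
  3<order = s≤s (s≤s (s≤s (ℕ.≤-trans (s≤s z≤n) (ℕ.m≤n+m (3 + k) m))))

  -- One cap, with rim vertices of degree 3.
  module Single where
    iso : Fin ((3 + m) + (3 + k)) ↔ V
    iso = Fin.+↔⊎

    open Enumerated iso _~_ _~?_ (λ {u} {v} → ~-sym {u} {v}) (λ {v} → ~-irrefl {v}) public
    open Inverse iso using (to)

    polyhedron : Polyhedron graph
    polyhedron = planar (record
      { pos           = λ u → ℤ.+ level (to u)
      ; pos-injective = λ eq → to-injective (level-injective (ℤ.+-injective eq))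
      ; Arc           = Arc²
      ; arc-<         = arc²-<
      ; uncrossed     = arcs²-uncrossed
      ; edge-arc      = λ u~v → map₂ (Sum.map front front) (joined u~v)
      }) , connected 3<order λ D → cap-linked (λ {u} {v} → ~-sym {u} {v}) id id id D

    A₁-graph : ∀ {z} → A₁ graph z ⇔ ∃ λ v → z ≡ ℤ.+ length (neighbours v)
    A₁-graph = degrees neighbours neighbours-unique λ v w → mk⇔ neighbours-complete neighbours-sound

  -- The band between two caps: the rung at each c, and if the first argument is
  -- true also the diagonal from c to prev c.  The first vertex is in the copy
  -- `false` and the second one in the copy `true`.
  Link : Bool → Rel V 0ℓ
  Link false (rim c) (rim d) = c ≡ d
  Link true  (rim c) (rim d) = c ≡ d ⊎ d ≡ prev c
  Link _     _       _       = ⊥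

  link? : ∀ diagonal → Decidable (Link diagonal)
  link? false (rim c) (rim d) = c Fin.≟ d
  link? true  (rim c) (rim d) = (c Fin.≟ d) ⊎-dec (d Fin.≟ prev c)
  link? false (rim _) (hub _) = no λ ()
  link? true  (rim _) (hub _) = no λ ()
  link? false (hub _) _       = no λ ()
  link? true  (hub _) _       = no λ ()

  -- links diagonal b v lists the neighbours of the vertex v of copy b in the other
  -- copy.
  links : Bool → Bool → V → List (Bool × V)
  links false b     (rim c) = (not b , rim c) ∷ []
  links true  false (rim c) = (true , rim c) ∷ (true , rim (prev c)) ∷ []
  links true  true  (rim d) = (false , rim d) ∷ (false , rim (next d)) ∷ []
  links _     _     (hub _) = []

  -- Two caps, with rim vertices of degree 4, or 5 if there are diagonals.
  module Double (diagonal : Bool) where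

    infix 4 _≈_ _≈?_

    _≈_ : Rel (Bool × V) 0ℓ
    (false , u) ≈ (false , v) = u ~ v
    (false , u) ≈ (true  , v) = Link diagonal u v
    (true  , u) ≈ (false , v) = Link diagonal v u
    (true  , u) ≈ (true  , v) = u ~ v

    _≈?_ : Decidable _≈_
    (false , u) ≈? (false , v) = u ~? v
    (false , u) ≈? (true  , v) = link? diagonal u v
    (true  , u) ≈? (false , v) = link? diagonal v u
    (true  , u) ≈? (true  , v) = u ~? v

    ≈-sym : Symmetric _≈_
    ≈-sym {false , u} {false , v} = ~-sym {u} {v}
    ≈-sym {false , u} {true  , v} = id
    ≈-sym {true  , u} {false , v} = id
    ≈-sym {true  , u} {true  , v} = ~-sym {u} {v}

    ≈-irrefl : ∀ {w} → ¬ (w ≈ w)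
    ≈-irrefl {false , u} = ~-irrefl {u}
    ≈-irrefl {true  , u} = ~-irrefl {u}

    -- Each copy carries the edges of the cap.
    within : ∀ b {u v} → u ~ v → (b , u) ≈ (b , v)
    within false e = e
    within true  e = e

    neighbours² : Bool × V → List (Bool × V)
    neighbours² (b , v) = map (b ,_) (neighbours v) ++ links diagonal b v

    links-complete : ∀ diagonal {u v} → Link diagonal u v →
                     (true , v) ∈ links diagonal false u × (false , u) ∈ links diagonal true v
    links-complete false {rim c} {rim d} refl = here refl , here refl
    links-complete true  {rim c} {rim d} (inj₁ refl) = here refl , here refl
    links-complete true  {rim c} {rim d} (inj₂ refl) =
      there (here refl) , there (here (cong (λ c → false , rim c) (sym (next-prev c))))
    links-complete false {hub _} ()
    links-complete true {hub _} ()
    links-complete true {rim _} {hub _} ()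

    links-sound : ∀ diagonal b {u c v} → (c , v) ∈ links diagonal b u →
      (b ≡ false × c ≡ true × Link diagonal u v) ⊎ (b ≡ true × c ≡ false × Link diagonal v u)
    links-sound false false {rim c} (here refl) = inj₁ (refl , refl , refl)
    links-sound false true  {rim c} (here refl) = inj₂ (refl , refl , refl)
    links-sound true  false {rim c} (here refl) = inj₁ (refl , refl , inj₁ refl)
    links-sound true  false {rim c} (there (here refl)) = inj₁ (refl , refl , inj₂ refl)
    links-sound true  true  {rim c} (here refl) = inj₂ (refl , refl , inj₁ refl)
    links-sound true  true  {rim c} (there (here refl)) = inj₂ (refl , refl , inj₂ (sym (prev-next c)))

    neighbours²-complete : ∀ {w x} → w ≈ x → x ∈ neighbours² w
    neighbours²-complete {false , u} {false , v} e = ∈-++⁺ˡ (∈-map⁺ (false ,_) (neighbours-complete e))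
    neighbours²-complete {false , u} {true  , v} e = ∈-++⁺ʳ _ (proj₁ (links-complete diagonal e))
    neighbours²-complete {true  , u} {false , v} e = ∈-++⁺ʳ _ (proj₂ (links-complete diagonal e))
    neighbours²-complete {true  , u} {true  , v} e = ∈-++⁺ˡ (∈-map⁺ (true ,_) (neighbours-complete e))

    neighbours²-sound : ∀ {w x} → x ∈ neighbours² w → w ≈ x
    neighbours²-sound {b , u} {x} x∈ with ∈-++⁻ (map (b ,_) (neighbours u)) x∈
    ... | inj₁ x∈ with v , v∈ , refl ← ∈-map⁻ (b ,_) x∈ = within b (neighbours-sound v∈)
    ... | inj₂ x∈ with links-sound diagonal b x∈
    ...   | inj₁ (refl , refl , e) = e
    ...   | inj₂ (refl , refl , e) = e

    links-unique : ∀ diagonal b v → Unique (links diagonal b v)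
    links-unique false b     (rim c) = [] ∷ []
    links-unique true  false (rim c) = ((λ eq → prev≢ c (sym (inj₁-injective (,-injectiveʳ eq)))) ∷ []) ∷ [] ∷ []
    links-unique true  true  (rim c) = ((λ eq → next≢ c (sym (inj₁-injective (,-injectiveʳ eq)))) ∷ []) ∷ [] ∷ []
    links-unique false b     (hub _) = []
    links-unique true  false (hub _) = []
    links-unique true  true  (hub _) = []

    neighbours²-unique : ∀ w → Unique (neighbours² w)
    neighbours²-unique (b , v) = Unique.++⁺
      (Unique.map⁺ ,-injectiveʳ (neighbours-unique v)) (links-unique diagonal b v)
      λ (x∈ , x∈′) → disjoint (∈-map⁻ (b ,_) x∈) (links-sound diagonal b x∈′)
      where
      disjoint : ∀ {c x} → (∃ λ u → u ∈ neighbours v × (c , x) ≡ (b , u)) →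
        (b ≡ false × c ≡ true × Link diagonal v x) ⊎ (b ≡ true × c ≡ false × Link diagonal x v) → ⊥
      disjoint (_ , _ , refl) (inj₁ (refl , () , _))
      disjoint (_ , _ , refl) (inj₂ (refl , () , _))

    rung : ∀ diagonal c → Link diagonal (rim c) (rim c)
    rung false c = refl
    rung true  c = inj₁ refl

    three-connected : ThreeConnected _≈_
    three-connected D = linked
      where
      open Deletion D
      open Linking {_~_ = _≈_} (λ {w} {x} → ≈-sym {w} {x}) D
      sheet : ∀ b → Linked _≈_ D (b ,_)
      sheet b = cap-linked (λ {w} {x} → ≈-sym {w} {x}) (b ,_) ,-injectiveʳ (within b) D
      across : ∀ u v → ¬ Gone (false , u) → ¬ Gone (true , v) → (false , u) ⇝ (true , v)
      across = join (false ,_) (true ,_) (λ ()) three three (λ t → rung diagonal (t Fin.↑ˡ m))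
        (λ eq → three-injective (,-injectiveʳ eq)) (λ eq → three-injective (,-injectiveʳ eq))
        (sheet false) (sheet true)
        where
        three : Fin 3 → V
        three t = rim (t Fin.↑ˡ m)
        three-injective : ∀ {s t} → three s ≡ three t → s ≡ t
        three-injective eq = Fin.↑ˡ-injective m _ _ (inj₁-injective eq)
      linked : Linked _≈_ D id
      linked (false , u) (false , v) u∉ v∉ = sheet false u v u∉ v∉
      linked (false , u) (true  , v) u∉ v∉ = across u v u∉ v∉
      linked (true  , u) (false , v) u∉ v∉ = ⇝-sym (across v u v∉ u∉)
      linked (true  , u) (true  , v) u∉ v∉ = sheet true u v u∉ v∉

    iso : Fin (2 ℕ.* ((3 + m) + (3 + k))) ↔ (Bool × V)
    iso = (Fin.2↔Bool ×-↔ Fin.+↔⊎) ↔-∘ Fin.*↔×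

    open Enumerated iso _≈_ _≈?_ (λ {w} {x} → ≈-sym {w} {x}) (λ {w} → ≈-irrefl {w}) public
    open Inverse iso using (to)

    -- The copy `true` lies to the right of the copy `false`.
    pos² : Bool × V → ℤ
    pos² (false , v) = -[1+ level v ]
    pos² (true  , v) = ℤ.+ level v

    pos²-injective : ∀ {w x} → pos² w ≡ pos² x → w ≡ x
    pos²-injective {false , u} {false , v} eq = cong (false ,_) (level-injective (ℤ.-[1+-injective eq))
    pos²-injective {true  , u} {true  , v} eq = cong (true ,_) (level-injective (ℤ.+-injective eq))

    Joined² : ℤ → ℤ → Set
    Joined² l r = ∃ λ b → Arc² b l r ⊎ Arc² b r l

    link-joined : ∀ diagonal {u v} → Link diagonal u v → ∃ λ b → Arc² b (pos² (false , u)) (pos² (true , v))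
    link-joined false {rim c} {rim d} refl = true , link c c ℕ.≤-refl (ℕ.n≤1+n _)
    link-joined true  {rim c} {rim d} (inj₁ refl) = true , link c c ℕ.≤-refl (ℕ.n≤1+n _)
    link-joined true  {rim zero} {rim _} (inj₂ refl) = false ,
      subst (λ l → Arc² false -[1+ 0 ] (ℤ.+ l)) (sym rim-level-last) twist
    link-joined true  {rim (suc c)} {rim _} (inj₂ refl) = true , link (suc c) (inject₁ c)
      (ℕ.m≤n⇒m≤1+n (ℕ.≤-reflexive (Fin.toℕ-inject₁ c))) (s≤s (ℕ.≤-reflexive (sym (Fin.toℕ-inject₁ c))))
    link-joined false {hub _} ()
    link-joined true {hub _} ()
    link-joined true {rim _} {hub _} ()

    joined² : ∀ {w x} → w ≈ x → Joined² (pos² w) (pos² x)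
    joined² {false , u} {false , v} e = map₂ (swap ∘ Sum.map back back) (joined {u} {v} e)
    joined² {false , u} {true  , v} e = map₂ inj₁ (link-joined diagonal e)
    joined² {true  , u} {false , v} e = map₂ inj₂ (link-joined diagonal e)
    joined² {true  , u} {true  , v} e = map₂ (Sum.map front front) (joined {u} {v} e)

    polyhedron : Polyhedron graph
    polyhedron = planar (record
      { pos           = pos² ∘ to
      ; pos-injective = to-injective ∘ pos²-injective
      ; Arc           = Arc²
      ; arc-<         = arc²-<
      ; uncrossed     = arcs²-uncrossed
      ; edge-arc      = joined²
      }) , connected (ℕ.<-≤-trans 3<order (ℕ.m≤m+n _ _)) three-connected

    A₁-graph : ∀ {z} → A₁ graph z ⇔ ∃ λ w → z ≡ ℤ.+ length (neighbours² w)
    A₁-graph = degrees neighbours² neighbours²-unique λ w x → mk⇔ neighbours²-complete neighbours²-sound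

    length-neighbours² : ∀ b v → length (neighbours² (b , v)) ≡
                         length (neighbours v) + length (links diagonal b v)
    length-neighbours² b v = trans (length-++ (map (b ,_) (neighbours v)))
      (cong (_+ length (links diagonal b v)) (length-map (b ,_) (neighbours v)))

-- Caps with prescribed hubs

-- A list of numbers e prescribes a cap whose hubs have 1 + e leaves each, hence
-- degree 3 + e.  Its rim has the following length.
size : List ℕ → ℕ
size es = sum (map suc es)

-- The first 1 + e rim vertices belong to the first hub, and so on.
owner : ∀ es → Fin (size es) → Fin (length es)
owner (e ∷ es)     zero    = zero
owner (zero ∷ es)  (suc c) = suc (owner es c)
owner (suc e ∷ es) (suc c) = owner (e ∷ es) c

owner-mono : ∀ es {c d} → c Fin.≤ d → owner es c Fin.≤ owner es d
owner-mono (e ∷ es)     {zero}                  _         = z≤n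
owner-mono (zero ∷ es)  {suc c} {suc d} (s≤s c≤d) = s≤s (owner-mono es c≤d)
owner-mono (suc e ∷ es) {suc c} {suc d} (s≤s c≤d) = owner-mono (e ∷ es) c≤d

-- The first leaf of each hub.
leaf : ∀ es → Fin (length es) → Fin (size es)
leaf (e ∷ es) zero    = zero
leaf (e ∷ es) (suc j) = suc e Fin.↑ʳ leaf es j

owner-leaf : ∀ es j → owner es (leaf es j) ≡ j
owner-leaf (e ∷ es) zero = refl
owner-leaf (e ∷ es) (suc j) = trans (skip e (leaf es j)) (cong suc (owner-leaf es j))
  where
  skip : ∀ e c → owner (e ∷ es) (suc e Fin.↑ʳ c) ≡ suc (owner es c)
  skip zero    c = refl
  skip (suc e) c = skip e c

length-filter-map : ∀ {A B : Set} {P : Pred B 0ℓ} {Q : Pred A 0ℓ}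
                    (P? : Unary.Decidable P) (Q? : Unary.Decidable Q)
                    (f : A → B) → (∀ x → P (f x) ⇔ Q x) → ∀ xs →
                    length (filter P? (map f xs)) ≡ length (filter Q? xs)
length-filter-map P? Q? f P⇔Q []       = refl
length-filter-map P? Q? f P⇔Q (x ∷ xs) with P? (f x) | Q? x
... | yes _ | yes _ = cong suc (length-filter-map P? Q? f P⇔Q xs)
... | yes p | no ¬q = contradiction (Equivalence.to (P⇔Q x) p) ¬q
... | no ¬p | yes q = contradiction (Equivalence.from (P⇔Q x) q) ¬p
... | no _  | no _  = length-filter-map P? Q? f P⇔Q xs

length-filter-suc : ∀ {n} {P : Pred (Fin (suc n)) 0ℓ} {Q : Pred (Fin n) 0ℓ}
                    (P? : Unary.Decidable P) (Q? : Unary.Decidable Q) → (∀ i → P (suc i) ⇔ Q i) →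
                    length (filter P? (tabulate suc)) ≡ length (filter Q? (allFin n))
length-filter-suc {n} P? Q? P⇔Q = trans (cong (length ∘ filter P?) (sym (map-tabulate id suc)))
  (length-filter-map P? Q? suc P⇔Q (allFin n))

-- The hub j has 1 + e leaves, where e is the j-th entry of the list.
fibre-size : ∀ es j → length (filter (λ c → owner es c Fin.≟ j) (allFin (size es))) ≡ suc (lookup es j)
fibre-size (zero ∷ es) zero = cong (suc ∘ length)
  (filter-none (λ c → owner (zero ∷ es) c Fin.≟ zero) (All.tabulate⁺ {f = Fin.suc} λ _ ()))
fibre-size (zero ∷ es) (suc j) = trans
  (length-filter-suc (λ c → owner (zero ∷ es) c Fin.≟ suc j) (λ c → owner es c Fin.≟ j)
    (λ _ → mk⇔ Fin.suc-injective (cong suc)))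
  (fibre-size es j)
fibre-size (suc e ∷ es) zero = cong suc (trans
  (length-filter-suc (λ c → owner (suc e ∷ es) c Fin.≟ zero) (λ c → owner (e ∷ es) c Fin.≟ zero)
    (λ _ → mk⇔ id id))
  (fibre-size (e ∷ es) zero))
fibre-size (suc e ∷ es) (suc j) = trans
  (length-filter-suc (λ c → owner (suc e ∷ es) c Fin.≟ suc j) (λ c → owner (e ∷ es) c Fin.≟ suc j)
    (λ _ → mk⇔ id id))
  (fibre-size (e ∷ es) (suc j))

-- The degrees that occur are 3 + x (on the rim) and 3 + e j (at the hubs).
HasDegrees : ∀ {K} → ℕ → (Fin K → ℕ) → Graph → Set
HasDegrees x e G = ∀ {z} → A₁ G z ⇔ (z ≡ + (3 + x) ⊎ ∃ λ j → z ≡ + (3 + e j))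

module _ {m k : ℕ} (owner : Fin (3 + m) → Fin (3 + k))
         (owner-mono : ∀ {c d} → c Fin.≤ d → owner c Fin.≤ owner d)
         (leaf : Fin (3 + k) → Fin (3 + m)) (owner-leaf : ∀ j → owner (leaf j) ≡ j)
         (e : Fin (3 + k) → ℕ)
         (fibre : ∀ j → length (filter (λ c → owner c Fin.≟ j) (allFin (3 + m))) ≡ suc (e j)) where
  open Cap owner owner-mono leaf owner-leaf
  open Graphs owner owner-mono leaf owner-leaf

  hub-degree : ∀ j → length (neighbours (hub j)) ≡ 3 + e j
  hub-degree j = cong (λ n → 2 + n) (trans (length-map rim (leaves j)) (fibre j))

  single-degrees : HasDegrees 0 e Single.graph
  single-degrees = mk⇔ (classify ∘ Equivalence.to Single.A₁-graph)
    (Equivalence.from Single.A₁-graph ∘ realise)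
    where
    classify : ∀ {z} → (∃ λ v → z ≡ + length (neighbours v)) → z ≡ + 3 ⊎ ∃ λ j → z ≡ + (3 + e j)
    classify (rim c , z≡) = inj₁ z≡
    classify (hub j , z≡) = inj₂ (j , trans z≡ (cong +_ (hub-degree j)))
    realise : ∀ {z} → z ≡ + 3 ⊎ (∃ λ j → z ≡ + (3 + e j)) → ∃ λ v → z ≡ + length (neighbours v)
    realise (inj₁ z≡)       = rim zero , z≡
    realise (inj₂ (j , z≡)) = hub j , trans z≡ (cong +_ (sym (hub-degree j)))

  links-number : Bool → ℕ
  links-number false = 1
  links-number true  = 2

  double-degrees : ∀ diagonal → HasDegrees (links-number diagonal) e (Double.graph diagonal)
  double-degrees diagonal = mk⇔ (classify ∘ Equivalence.to A₁-graph) (Equivalence.from A₁-graph ∘ realise)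
    where
    open Double diagonal
    rim-degree² : ∀ b c → length (neighbours² (b , rim c)) ≡ 3 + links-number diagonal
    rim-degree² b c = trans (length-neighbours² b (rim c)) (cong (λ n → 3 + n) (go diagonal b))
      where
      go : ∀ diagonal b → length (links diagonal b (rim c)) ≡ links-number diagonal
      go false b     = refl
      go true  false = refl
      go true  true  = refl
    hub-degree² : ∀ b j → length (neighbours² (b , hub j)) ≡ 3 + e j
    hub-degree² b j = trans (length-neighbours² b (hub j))
      (trans (cong₂ _+_ (hub-degree j) (go diagonal b)) (ℕ.+-identityʳ _))
      where
      go : ∀ diagonal b → length (links diagonal b (hub j)) ≡ 0
      go false b     = refl
      go true  false = refl
      go true  true  = refl
    classify : ∀ {z} → (∃ λ w → z ≡ + length (neighbours² w)) →
               z ≡ + (3 + links-number diagonal) ⊎ ∃ λ j → z ≡ + (3 + e j)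
    classify ((b , rim c) , z≡) = inj₁ (trans z≡ (cong +_ (rim-degree² b c)))
    classify ((b , hub j) , z≡) = inj₂ (j , trans z≡ (cong +_ (hub-degree² b j)))
    realise : ∀ {z} → z ≡ + (3 + links-number diagonal) ⊎ (∃ λ j → z ≡ + (3 + e j)) →
              ∃ λ w → z ≡ + length (neighbours² w)
    realise (inj₁ z≡)       = (false , rim zero) , trans z≡ (cong +_ (sym (rim-degree² false zero)))
    realise (inj₂ (j , z≡)) = (false , hub j) , trans z≡ (cong +_ (sym (hub-degree² false j)))

  -- The factor suc (x ⊓ 1) is the number of caps: 1 if x = 0, and 2 otherwise.
  cap-polyhedron : ∀ x → x ℕ.≤ 2 → ∃ λ G → Polyhedron G × HasDegrees x e G ×
                   Graph.order G ≡ suc (x ℕ.⊓ 1) * ((3 + m) + (3 + k))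
  cap-polyhedron 0 _ = Single.graph , Single.polyhedron , single-degrees , sym (ℕ.+-identityʳ _)
  cap-polyhedron 1 _ = Double.graph false , Double.polyhedron false , double-degrees false , refl
  cap-polyhedron 2 _ = Double.graph true , Double.polyhedron true , double-degrees true , refl
  cap-polyhedron (suc (suc (suc _))) (s≤s (s≤s ()))

-- The same for a rim whose length is only known to be at least 3.
fibred-polyhedron : ∀ {N k} (owner : Fin N → Fin (3 + k)) → (∀ {c d} → c Fin.≤ d → owner c Fin.≤ owner d) →
  (leaf : Fin (3 + k) → Fin N) → (∀ j → owner (leaf j) ≡ j) → (e : Fin (3 + k) → ℕ) →
  (∀ j → length (filter (λ c → owner c Fin.≟ j) (allFin N)) ≡ suc (e j)) →
  3 ℕ.≤ N → ∀ x → x ℕ.≤ 2 → ∃ λ G → Polyhedron G × HasDegrees x e G ×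
    Graph.order G ≡ suc (x ℕ.⊓ 1) * (N + (3 + k))
fibred-polyhedron owner mono leaf owner-leaf e fibre 3≤N with m , refl ← ℕ.m≤n⇒∃[o]m+o≡n 3≤N =
  cap-polyhedron owner mono leaf owner-leaf e fibre

length≤size : ∀ es → length es ℕ.≤ size es
length≤size []       = z≤n
length≤size (e ∷ es) = s≤s (ℕ.≤-trans (length≤size es) (ℕ.m≤n+m _ e))

polyhedron-with-hubs : ∀ x → x ℕ.≤ 2 → ∀ es → 3 ℕ.≤ length es →
  ∃ λ G → Polyhedron G × HasDegrees x (lookup es) G × Graph.order G ≡ suc (x ℕ.⊓ 1) * (size es + length es)
polyhedron-with-hubs x x≤2 es@(_ ∷ _ ∷ _ ∷ _) 3≤ =
  fibred-polyhedron (owner es) (owner-mono es) (leaf es) (owner-leaf es) (lookup es) (fibre-size es)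
    (ℕ.≤-trans 3≤ (length≤size es)) x x≤2
polyhedron-with-hubs x x≤2 (_ ∷ [])     (s≤s ())
polyhedron-with-hubs x x≤2 (_ ∷ _ ∷ []) (s≤s (s≤s ()))

HasDegrees⇒A₁ : ∀ {A : List ℤ} {x es G} → HasDegrees x (lookup es) G → + (3 + x) ∈ A →
  All (λ e → + (3 + e) ∈ A) es → (∀ {z} → z ∈ A → ∃ λ e → e ∈ es × z ≡ + (3 + e)) → A₁ G ≐ (_∈ A)
HasDegrees⇒A₁ {A} {es = es} degrees x∈ es⊆ ⊆es =
  (λ z∈ → [ (λ { refl → x∈ }) , (λ { (j , refl) → All.lookup es⊆ (∈-lookup {xs = es} j) }) ]′
    (Equivalence.to degrees z∈)) ,
  (λ z∈ → let e , e∈ , z≡ = ⊆es z∈ in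
    Equivalence.from degrees (inj₂ (Any.index e∈ , trans z≡ (cong (λ e → + (3 + e)) (Any.lookup-index e∈)))))

-- Degree sets with minimum 3, 4 or 5

-- The excess of a degree over 3.
excess : ℤ → ℕ
excess z = ℤ.∣ z ∣ ∸ 3

excess-spec : ∀ {z} → + 3 ≤ z → z ≡ + (3 + excess z)
excess-spec (ℤ.+≤+ 3≤n) = cong +_ (sym (ℕ.m+[n∸m]≡n 3≤n))

-- The number of vertices of a cap.
weight : List ℕ → ℕ
weight es = size es + length es

weight-replicate : ∀ i x es → weight (replicate i x ++ es) ≡ i * (2 + x) + weight es
weight-replicate zero    x es = refl
weight-replicate (suc i) x es = begin
  suc x + s + suc l
    ≡⟨ solve 3 (λ x s l → con 1 :+ x :+ s :+ (con 1 :+ l) := con 2 :+ x :+ (s :+ l)) refl x s l ⟩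
  2 + x + (s + l)                      ≡⟨ cong (λ w → 2 + x + w) (weight-replicate i x es) ⟩
  2 + x + (i * (2 + x) + weight es)    ≡⟨ sym (ℕ.+-assoc (2 + x) (i * (2 + x)) (weight es)) ⟩
  2 + x + i * (2 + x) + weight es      ∎
  where
  open ≡-Reasoning
  open ℕ-Solver.+-*-Solver
  s = size (replicate i x ++ es)
  l = length (replicate i x ++ es)

weight-replicate-injective : ∀ i j x es → weight (replicate i x ++ es) ≡ weight (replicate j x ++ es) → i ≡ j
weight-replicate-injective i j x es eq = ℕ.*-cancelʳ-≡ i j (2 + x) (ℕ.+-cancelʳ-≡ (weight es) _ _
  (trans (sym (weight-replicate i x es)) (trans eq (weight-replicate j x es))))

≅-order : ∀ {G H} → G ≅ H → Graph.order G ≡ Graph.order H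
≅-order iso = ↔⇒≡ (_≅_.bijection iso)

corollaryC2 : (A : List ℤ) (a : ℤ) → IsMinimum a A → + 3 ≤ a → a ≤ + 5 →
    ∃ λ (G : ℕ → Graph) →
    (∀ i → Polyhedron (G i) × (A₁ (G i) ≐ (_∈ A))) ×
    (∀ i j → i ≢ j → ¬ (G i ≅ G j))
corollaryC2 A a (a∈A , a≤) 3≤a a≤5 =
  (λ i → proj₁ (family i)) ,
  (λ i → proj₁ (proj₂ (family i)) ,
    HasDegrees⇒A₁ {G = proj₁ (family i)} (proj₁ (proj₂ (proj₂ (family i)))) x∈A (es⊆A i) (A⊆es i)) ,
  λ i j i≢j G≅H → i≢j (ℕ.+-cancelˡ-≡ 3 _ _ (weight-replicate-injective (3 + i) (3 + j) x B
    (ℕ.*-cancelˡ-≡ _ _ (suc (x ℕ.⊓ 1))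
      (trans (sym (order i)) (trans (≅-order G≅H) (order j))))))
  where
  x : ℕ
  x = excess a
  B : List ℕ
  B = map excess A
  -- 3 + i hubs of degree a and one hub for each member of A.  Three hubs are
  -- needed for a cycle.
  es : ℕ → List ℕ
  es i = replicate (3 + i) x ++ B
  x≤2 : x ℕ.≤ 2
  x≤2 with ℤ.+≤+ n≤5 ← subst (_≤ + 5) (excess-spec 3≤a) a≤5 = ℕ.+-cancelˡ-≤ 3 x 2 n≤5
  excess-∈ : ∀ {z} → z ∈ A → z ≡ + (3 + excess z)
  excess-∈ z∈ = excess-spec (ℤ.≤-trans 3≤a (a≤ z∈))
  x∈A : + (3 + x) ∈ A
  x∈A = subst (_∈ A) (excess-∈ a∈A) a∈A
  es⊆A : ∀ i → All (λ e → + (3 + e) ∈ A) (es i)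
  es⊆A i = All.++⁺ (All.replicate⁺ (3 + i) x∈A)
    (All.map⁺ (All.tabulate λ z∈ → subst (_∈ A) (excess-∈ z∈) z∈))
  A⊆es : ∀ i {z} → z ∈ A → ∃ λ e → e ∈ es i × z ≡ + (3 + e)
  A⊆es i {z} z∈ = excess z , ∈-++⁺ʳ (replicate (3 + i) x) (∈-map⁺ excess z∈) , excess-∈ z∈
  family : ∀ i → _
  family i = polyhedron-with-hubs x x≤2 (es i) (s≤s (s≤s (s≤s z≤n)))
  order : ∀ i → Graph.order (proj₁ (family i)) ≡ suc (x ℕ.⊓ 1) * weight (es i)
  order i = proj₂ (proj₂ (proj₂ (family i)))
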